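{- Let $\ell\ge2$, let $b^\ell_k$ be the number of $\ell$-partitions whose first part equals $k$, and let $B_\ell(x)=\sum_{k=0}^\infty b^\ell_k x^k$. Then $$B_\ell(x)=\frac{1-x^{\ell-1}}{(1-x)^{\ell-1}\,(1-x^{\ell-1}-x^{\ell})}.$$
   Context: The empty partition is the unique partition with first part $0$. A partition is $\ell$-regular if it does not have $\ell$ or more equal nonzero parts. A removable $\ell$-rim hook (for short, $\ell$-rim hook) of $\lambda$ is a connected sequence of $\ell$ boxes of the Young diagram of $\lambda$, containing no $2\times2$ square, whose removal from $\lambda$ leaves the Young diagram of a partition. It is horizontal if all its boxes lie in one row, and non-horizontal otherwise. An $\ell$-partition is an $\ell$-regular partition (of any size) which has no non-horizontal $\ell$-rim hooks and such that, after removing any number of horizontal $\ell$-rim hooks in any order, the remaining diagram has no non-horizontal $\ell$-rim hooks. The identity is one of formal power series. -}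

module Defs where

open import Algebra.Properties.Semiring.Sum using (sum⁺-syntax)
open import Data.Fin.Base using (toℕ)
open import Data.Integer.Base as ℤ using (ℤ; 0ℤ; 1ℤ)
import Data.Integer.Properties as ℤ
open import Data.List.Base using (List; []; _∷_; length; filter)
open import Data.List.Membership.Propositional using (_∈_; _∉_)
open import Data.List.Relation.Unary.All using (All)
open import Data.List.Relation.Unary.Linked using (Linked)
open import Data.List.Relation.Unary.Unique.Propositional using (Unique)
open import Data.Nat.Base using (ℕ; zero; suc; _∸_; _<_; _≥_)
open import Data.Nat.Properties using (_≟_)
open import Data.Product.Base using (_×_; _,_; Σ-syntax; ∃-syntax; proj₁)
open import Function.Bundles using (_⇔_)
open import Relation.Binary.Construct.Closure.ReflexiveTransitive using (Star)
open import Relation.Binary.PropositionalEquality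
  using (_≡_; cong; module ≡-Reasoning)
open import Relation.Nullary.Negation.Core using (¬_)

------------------------------------------------------------------------
-- Partitions

record Partition : Set where
  constructor mkPartition
  field
    parts      : List ℕ
    decreasing : Linked _≥_ parts
    positive   : All (0 <_) parts

open Partition public

-- Entries are numbered from 0; past the end of the list they are 0.
entry : List ℕ → ℕ → ℕ
entry []       _       = 0
entry (x ∷ _)  zero    = x
entry (_ ∷ xs) (suc i) = entry xs i

firstPart : Partition → ℕ
firstPart α = entry (parts α) 0

Regular : ℕ → Partition → Set
Regular ℓ α = ∀ v → length (filter (_≟ v) (parts α)) < ℓ

------------------------------------------------------------------------
-- Young diagrams and rim hooks

-- (row , column), both numbered from 0.
Box : Set
Box = ℕ × ℕ

infix 4 _∈ʸ_

_∈ʸ_ : Box → Partition → Set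
(i , j) ∈ʸ α = j < entry (parts α) i

data Adjacent : Box → Box → Set where
  right : ∀ {i j} → Adjacent (i , j) (i , suc j)
  left  : ∀ {i j} → Adjacent (i , suc j) (i , j)
  down  : ∀ {i j} → Adjacent (i , j) (suc i , j)
  up    : ∀ {i j} → Adjacent (suc i , j) (i , j)

ContainsSquare : List Box → Set
ContainsSquare bs = ∃[ i ] ∃[ j ]
  (i , j) ∈ bs × (i , suc j) ∈ bs × (suc i , j) ∈ bs × (suc i , suc j) ∈ bs

-- RimHook ℓ α β: the removable ℓ-rim hooks of α whose removal leaves β.
record RimHook (ℓ : ℕ) (α β : Partition) : Set where
  field
    boxes     : List Box
    size      : length boxes ≡ ℓ
    distinct  : Unique boxes
    inside    : All (_∈ʸ α) boxes
    connected : Linked Adjacent boxes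
    noSquare  : ¬ ContainsSquare boxes
    removal   : ∀ b → b ∈ʸ β ⇔ (b ∈ʸ α × b ∉ boxes)

open RimHook public

Horizontal : ∀ {ℓ α β} → RimHook ℓ α β → Set
Horizontal h = ∃[ i ] All (λ b → proj₁ b ≡ i) (boxes h)

HasNonHorizontalHook : ℕ → Partition → Set
HasNonHorizontalHook ℓ α = ∃[ β ] Σ[ h ∈ RimHook ℓ α β ] ¬ Horizontal h

RemoveHorizontal : ℕ → Partition → Partition → Set
RemoveHorizontal ℓ α β = Σ[ h ∈ RimHook ℓ α β ] Horizontal h

-- Star allows zero removals, so α itself is covered by the second field.
record IsℓPartition (ℓ : ℕ) (α : Partition) : Set where
  field
    regular         : Regular ℓ α
    noNonHorizontal : ∀ β → Star (RemoveHorizontal ℓ) α β → ¬ HasNonHorizontalHook ℓ β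

------------------------------------------------------------------------
-- Finite cardinality

-- Exactly n elements satisfy P. An element counts once, however many proofs of
-- P it has.
HasSize : {A : Set} → (A → Set) → ℕ → Set
HasSize {A} P n =
  Σ[ xs ∈ List A ] Unique xs × (∀ a → a ∈ xs ⇔ P a) × length xs ≡ n

------------------------------------------------------------------------
-- Formal power series over ℤ, as coefficient sequences

PowerSeries : Set
PowerSeries = ℕ → ℤ

infix  4 _≈_
infixl 6 _-_
infixl 7 _*_ _/_
infixr 8 _^_

_≈_ : PowerSeries → PowerSeries → Set
f ≈ g = ∀ n → f n ≡ g n

𝟙 : PowerSeries
𝟙 zero    = 1ℤ
𝟙 (suc _) = 0ℤ

X : PowerSeries
X zero    = 0ℤ
X (suc n) = 𝟙 n

_-_ : PowerSeries → PowerSeries → PowerSeries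
(f - g) n = f n ℤ.- g n

_*_ : PowerSeries → PowerSeries → PowerSeries
(f * g) n = sum⁺-syntax ℤ.+-*-semiring n λ i → f (toℕ i) ℤ.* g (n ∸ toℕ i)

_^_ : PowerSeries → ℕ → PowerSeries
f ^ zero  = 𝟙
f ^ suc n = f * f ^ n

-- Long division. Meaningful only when g has constant coefficient 1, in which
-- case it is the quotient in ℤ[[x]], by /-*-cancel.
_/_ : PowerSeries → PowerSeries → PowerSeries
(f / g) zero    = f 0
(f / g) (suc n) = ((λ m → f (suc m) ℤ.- f 0 ℤ.* g (suc m)) / g) n

/-*-cancel : ∀ f g → g 0 ≡ 1ℤ → (f / g) * g ≈ f
/-*-cancel f g g₀≡1 zero = begin
  f 0 ℤ.* g 0 ℤ.+ 0ℤ  ≡⟨ ℤ.+-identityʳ _ ⟩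
  f 0 ℤ.* g 0         ≡⟨ cong (f 0 ℤ.*_) g₀≡1 ⟩
  f 0 ℤ.* 1ℤ          ≡⟨ ℤ.*-identityʳ _ ⟩
  f 0                 ∎
  where open ≡-Reasoning
/-*-cancel f g g₀≡1 (suc n) = begin
  c ℤ.+ ((f′ / g) * g) n       ≡⟨ cong (λ z → c ℤ.+ z) (/-*-cancel f′ g g₀≡1 n) ⟩
  c ℤ.+ (f (suc n) ℤ.- c)      ≡⟨ ℤ.+-comm c _ ⟩
  f (suc n) ℤ.- c ℤ.+ c        ≡⟨ ℤ.+-assoc (f (suc n)) _ c ⟩
  f (suc n) ℤ.+ (ℤ.- c ℤ.+ c)  ≡⟨ cong (λ z → f (suc n) ℤ.+ z) (ℤ.+-inverseˡ c) ⟩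
  f (suc n) ℤ.+ 0ℤ             ≡⟨ ℤ.+-identityʳ _ ⟩
  f (suc n)                    ∎
  where
  open ≡-Reasoning
  c : ℤ
  c = f 0 ℤ.* g (suc n)
  f′ : PowerSeries
  f′ m = f (suc m) ℤ.- f 0 ℤ.* g (suc m)

generatingSeries : (ℕ → ℕ) → PowerSeries
generatingSeries b n = ℤ.+ b n

{-# OPTIONS --safe #-}
module Submission where

-- An ℓ-rim hook with rows a, …, a + m exists exactly when
-- λ_{a+m+1} + ℓ ≤ λ_a + m < λ_{a+m} + ℓ. In these terms, an ℓ-partition whose first
-- two parts differ by less than ℓ ∸ 1 is an ℓ-core: otherwise some two adjacent rows
-- would carry a non-horizontal hook. Deleting the first row is a bijection from the
-- ℓ-partitions with difference ℓ ∸ 1 to all ℓ-partitions, and so is shortening the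
-- first row by ℓ on those with difference at least ℓ. Hence B = Z + (x^{ℓ-1} + x^ℓ) B,
-- where Z counts the ℓ-cores with first difference less than ℓ ∸ 1.
--
-- An ℓ-core is determined by the numbers g_1, …, g_{ℓ-1} of gaps of its boundary word
-- in each residue class of distances below the top bead. These are arbitrary, they add
-- up to the first part, and the first difference is less than ℓ ∸ 1 exactly when some
-- g_j vanishes; so Z = (1 - x^{ℓ-1}) / (1 - x)^{ℓ-1}.

open import Defs
open import Algebra.Bundles using (CommutativeSemigroup)
import Algebra.Properties.CommutativeSemigroup as CommutativeSemigroupProperties
open import Data.Empty using (⊥)
open import Data.Integer.Base as ℤ using (0ℤ; 1ℤ)
import Data.Integer.Properties as ℤ
import Data.Integer.Tactic.RingSolver as ℤ-Solver
open import Data.List.Base using (List; []; _∷_; length; map; _++_; replicate; filter)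
open import Data.List.Membership.Propositional using (_∈_; _∉_)
import Data.List.Membership.DecPropositional as DecMembership
open import Data.List.Membership.Propositional.Properties
  using (∈-map⁺; ∈-map⁻; ∈-++⁺ˡ; ∈-++⁺ʳ; ∈-++⁻)
open import Data.List.Properties
  using (length-map; length-++; length-replicate; ++-assoc; ∷-injectiveˡ; ∷-injectiveʳ; filter-accept; filter-reject)
open import Data.List.Relation.Unary.All as All using (All; []; _∷_)
open import Data.List.Relation.Unary.AllPairs using (AllPairs; []; _∷_)
import Data.List.Relation.Unary.AllPairs.Properties as AllPairs
open import Data.List.Relation.Unary.Any using (here; there)
open import Data.List.Relation.Unary.Linked as Linked using (Linked; []; [-]; _∷_)
open import Data.List.Relation.Unary.Unique.Propositional using (Unique)
import Data.List.Relation.Unary.Unique.Propositional.Properties as Unique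
open import Data.Nat.Base
  using (ℕ; zero; suc; pred; _+_; _∸_; _≤_; _<_; _≥_; z≤n; s≤s; z<s; s≤s⁻¹; >-nonZero)
open import Data.Nat.ListAction using (sum)
open import Data.Nat.ListAction.Properties using (sum-++)
import Data.Nat.Properties as ℕ
import Data.Nat.Tactic.RingSolver as ℕ-Solver
open import Data.Product.Base using (_×_; _,_; ∃-syntax; Σ-syntax; proj₁; proj₂)
open import Data.Product.Properties using (≡-dec)
open import Data.Sum.Base using (_⊎_; inj₁; inj₂)
open import Function.Base using (_∘_)
open import Function.Bundles using (mk⇔; Equivalence)
open import Level using (0ℓ)
open import Relation.Binary.Construct.Closure.ReflexiveTransitive using (Star; ε; _◅_)
open import Relation.Binary.Definitions using (tri<; tri≈; tri>)
open import Relation.Binary.PropositionalEquality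
  using (_≡_; _≢_; refl; sym; trans; cong; cong₂; subst; subst₂; ≢-sym; module ≡-Reasoning)
import Relation.Binary.Reasoning.Setoid as SetoidReasoning
open import Relation.Nullary using (¬_; yes; no; contradiction)
open import Relation.Nullary.Decidable using (decidable-stable)

-- Power series

-- If the bottom row a + m of a hook keeps v boxes, the rim from there up to row a has λ_a + m - v
-- boxes. So v = λ_a + m - ℓ, and the rest is a partition exactly when λ_{a+m+1} ≤ v < λ_{a+m}. The
-- obstacle is that an ℓ-partition is defined through all sequences of removals, and these do not
-- respect the two bijections: a hook taken from the second row, below a row of difference ℓ - 1,
-- makes that difference 2ℓ - 1. The remedy is the inductive class `Generated`: the result is again
-- an adjoined row that has been widened, so the class is closed under removal. For cores put n = ℓ
-- - 1 and let d be the first difference. If d < n, the second bead lies at distance d + 1, in a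
-- class without gaps, while the classes 1, ..., d have one gap each between the two beads. Hence d
-- is the number of entries of g before its first zero, and g rebuilds the core row by row. If d =
-- n, every class has one gap there, so g has no zero. Vectors of length n without a zero have the
-- series x^n / (1 - x)^n, and Z is what remains of 1 / (1 - x)^n.

shift : PowerSeries → PowerSeries
shift f n = f (suc n)

*-congʳ : ∀ {f f′} g → f ≈ f′ → f * g ≈ f′ * g
*-congʳ g e zero    = cong (λ z → z ℤ.* g 0 ℤ.+ 0ℤ) (e 0)
*-congʳ g e (suc n) = cong₂ (λ y z → y ℤ.* g (suc n) ℤ.+ z) (e 0) (*-congʳ g (e ∘ suc) n)

*-congˡ : ∀ f {g g′} → g ≈ g′ → f * g ≈ f * g′
*-congˡ f e zero    = cong (λ z → f 0 ℤ.* z ℤ.+ 0ℤ) (e 0)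
*-congˡ f e (suc n) = cong₂ (λ y z → f 0 ℤ.* y ℤ.+ z) (e (suc n)) (*-congˡ (shift f) e n)

-- The product computes by splitting off its first term. Commutativity needs the mirror image, which
-- splits off the last one.
*-sucʳ : ∀ f g n → (f * g) (suc n) ≡ (f * shift g) n ℤ.+ f (suc n) ℤ.* g 0
*-sucʳ f g zero    = lemma (f 0) (f 1) (g 0) (g 1)
  where
  lemma : ∀ a b c d → a ℤ.* d ℤ.+ (b ℤ.* c ℤ.+ 0ℤ) ≡ a ℤ.* d ℤ.+ 0ℤ ℤ.+ b ℤ.* c
  lemma = ℤ-Solver.solve-∀
*-sucʳ f g (suc n) = trans
  (cong (λ z → f 0 ℤ.* g (suc (suc n)) ℤ.+ z) (*-sucʳ (shift f) g n))
  (sym (ℤ.+-assoc (f 0 ℤ.* g (suc (suc n))) ((shift f * shift g) n) _))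

*-comm : ∀ f g → f * g ≈ g * f
*-comm f g zero    = cong (ℤ._+ 0ℤ) (ℤ.*-comm (f 0) (g 0))
*-comm f g (suc n) = begin
  f 0 ℤ.* g (suc n) ℤ.+ (shift f * g) n  ≡⟨ cong₂ ℤ._+_ (ℤ.*-comm (f 0) (g (suc n))) (*-comm (shift f) g n) ⟩
  g (suc n) ℤ.* f 0 ℤ.+ (g * shift f) n  ≡⟨ ℤ.+-comm (g (suc n) ℤ.* f 0) _ ⟩
  (g * shift f) n ℤ.+ g (suc n) ℤ.* f 0  ≡⟨ *-sucʳ g f n ⟨
  (g * f) (suc n)                        ∎
  where open ≡-Reasoning

-- The shape c f + g is that of `shift (f * g)`, namely `f 0` times `shift g` plus `shift f * g`;
-- associativity uses it in this form.
*-linearˡ : ∀ c f g h → (λ m → c ℤ.* f m ℤ.+ g m) * h ≈ λ m → c ℤ.* (f * h) m ℤ.+ (g * h) m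
*-linearˡ c f g h zero = lemma c (f 0) (g 0) (h 0)
  where
  lemma : ∀ c x y z → (c ℤ.* x ℤ.+ y) ℤ.* z ℤ.+ 0ℤ ≡ c ℤ.* (x ℤ.* z ℤ.+ 0ℤ) ℤ.+ (y ℤ.* z ℤ.+ 0ℤ)
  lemma = ℤ-Solver.solve-∀
*-linearˡ c f g h (suc n) = trans
  (cong (λ z → (c ℤ.* f 0 ℤ.+ g 0) ℤ.* h (suc n) ℤ.+ z) (*-linearˡ c (shift f) (shift g) h n))
  (lemma c (f 0) (g 0) (h (suc n)) ((shift f * h) n) ((shift g * h) n))
  where
  lemma : ∀ c x y z a b → (c ℤ.* x ℤ.+ y) ℤ.* z ℤ.+ (c ℤ.* a ℤ.+ b) ≡ c ℤ.* (x ℤ.* z ℤ.+ a) ℤ.+ (y ℤ.* z ℤ.+ b)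
  lemma = ℤ-Solver.solve-∀

*-assoc : ∀ f g h → (f * g) * h ≈ f * (g * h)
*-assoc f g h zero = lemma (f 0) (g 0) (h 0)
  where
  lemma : ∀ x y z → (x ℤ.* y ℤ.+ 0ℤ) ℤ.* z ℤ.+ 0ℤ ≡ x ℤ.* (y ℤ.* z ℤ.+ 0ℤ) ℤ.+ 0ℤ
  lemma = ℤ-Solver.solve-∀
*-assoc f g h (suc n) = begin
  (f 0 ℤ.* g 0 ℤ.+ 0ℤ) ℤ.* h (suc n) ℤ.+ (shift (f * g) * h) n
    ≡⟨ cong (λ z → (f 0 ℤ.* g 0 ℤ.+ 0ℤ) ℤ.* h (suc n) ℤ.+ z) (*-linearˡ (f 0) (shift g) (shift f * g) h n) ⟩
  (f 0 ℤ.* g 0 ℤ.+ 0ℤ) ℤ.* h (suc n) ℤ.+ (f 0 ℤ.* (shift g * h) n ℤ.+ ((shift f * g) * h) n)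
    ≡⟨ cong (λ z → (f 0 ℤ.* g 0 ℤ.+ 0ℤ) ℤ.* h (suc n) ℤ.+ (f 0 ℤ.* (shift g * h) n ℤ.+ z)) (*-assoc (shift f) g h n) ⟩
  (f 0 ℤ.* g 0 ℤ.+ 0ℤ) ℤ.* h (suc n) ℤ.+ (f 0 ℤ.* (shift g * h) n ℤ.+ (shift f * (g * h)) n)
    ≡⟨ lemma (f 0) (g 0) (h (suc n)) ((shift g * h) n) _ ⟩
  f 0 ℤ.* (g * h) (suc n) ℤ.+ (shift f * (g * h)) n ∎
  where
  open ≡-Reasoning
  lemma : ∀ x y z a b → (x ℤ.* y ℤ.+ 0ℤ) ℤ.* z ℤ.+ (x ℤ.* a ℤ.+ b) ≡ x ℤ.* (y ℤ.* z ℤ.+ a) ℤ.+ b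
  lemma = ℤ-Solver.solve-∀

*-distribʳ-- : ∀ f g h → (f - g) * h ≈ f * h - g * h
*-distribʳ-- f g h zero = lemma (f 0) (g 0) (h 0)
  where
  lemma : ∀ x y z → (x ℤ.- y) ℤ.* z ℤ.+ 0ℤ ≡ x ℤ.* z ℤ.+ 0ℤ ℤ.- (y ℤ.* z ℤ.+ 0ℤ)
  lemma = ℤ-Solver.solve-∀
*-distribʳ-- f g h (suc n) = trans
  (cong (λ z → (f 0 ℤ.- g 0) ℤ.* h (suc n) ℤ.+ z) (*-distribʳ-- (shift f) (shift g) h n))
  (lemma (f 0) (g 0) (h (suc n)) ((shift f * h) n) ((shift g * h) n))
  where
  lemma : ∀ x y z a b → (x ℤ.- y) ℤ.* z ℤ.+ (a ℤ.- b) ≡ x ℤ.* z ℤ.+ a ℤ.- (y ℤ.* z ℤ.+ b)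
  lemma = ℤ-Solver.solve-∀

*-zeroˡ : ∀ g → (λ _ → 0ℤ) * g ≈ λ _ → 0ℤ
*-zeroˡ g zero    = refl
*-zeroˡ g (suc n) = trans (ℤ.+-identityˡ _) (*-zeroˡ g n)

𝟙-* : ∀ g → 𝟙 * g ≈ g
𝟙-* g zero    = trans (ℤ.+-identityʳ _) (ℤ.*-identityˡ (g 0))
𝟙-* g (suc n) = trans (cong₂ ℤ._+_ (ℤ.*-identityˡ (g (suc n))) (*-zeroˡ g n)) (ℤ.+-identityʳ _)

X-*-suc : ∀ g n → (X * g) (suc n) ≡ g n
X-*-suc g n = trans (ℤ.+-identityˡ _) (𝟙-* g n)

-- Any cofactor of g in h is the quotient, because long division computes the
-- coefficients of f one after the other.
/-unique : ∀ f g h → g 0 ≡ 1ℤ → f * g ≈ h → f ≈ h / g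
/-unique f g h g₀≡1 e zero = f₀≡h₀
  where
  f₀≡h₀ : f 0 ≡ h 0
  f₀≡h₀ = trans (sym (ℤ.*-identityʳ (f 0)))
         (trans (cong (f 0 ℤ.*_) (sym g₀≡1))
         (trans (sym (ℤ.+-identityʳ _)) (e 0)))
/-unique f g h g₀≡1 e (suc n) = /-unique (shift f) g _ g₀≡1 tail n
  where
  lemma : ∀ x y → y ≡ x ℤ.+ y ℤ.- x
  lemma = ℤ-Solver.solve-∀
  tail : shift f * g ≈ λ m → h (suc m) ℤ.- h 0 ℤ.* g (suc m)
  tail m = trans (lemma (f 0 ℤ.* g (suc m)) _)
    (cong₂ (λ y z → y ℤ.- z ℤ.* g (suc m)) (e (suc m)) (/-unique f g h g₀≡1 e 0))

*-commutativeSemigroup : CommutativeSemigroup 0ℓ 0ℓ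
*-commutativeSemigroup = record
  { Carrier = PowerSeries
  ; _≈_     = _≈_
  ; _∙_     = _*_
  ; isCommutativeSemigroup = record
    { isSemigroup = record
      { isMagma = record
        { isEquivalence = record
          { refl  = λ _ → refl
          ; sym   = λ e n → sym (e n)
          ; trans = λ e e′ n → trans (e n) (e′ n)
          }
        ; ∙-cong = λ {f} {f′} {g} e e′ n → trans (*-congʳ g e n) (*-congˡ f′ e′ n)
        }
      ; assoc = *-assoc
      }
    ; comm = *-comm
    }
  }

open CommutativeSemigroup *-commutativeSemigroup using (setoid)
open CommutativeSemigroupProperties *-commutativeSemigroup using (x∙yz≈y∙xz)
module ≈-Reasoning = SetoidReasoning setoid

infixl 6 _⊕_

_⊕_ : PowerSeries → PowerSeries → PowerSeries
(f ⊕ g) n = f n ℤ.+ g n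

⊕-cong : ∀ {f f′ g g′} → f ≈ f′ → g ≈ g′ → f ⊕ g ≈ f′ ⊕ g′
⊕-cong e e′ n = cong₂ ℤ._+_ (e n) (e′ n)

*-distribʳ-⊕ : ∀ f g h → (g ⊕ h) * f ≈ g * f ⊕ h * f
*-distribʳ-⊕ f g h n = trans
  (*-congʳ f (λ m → cong (ℤ._+ h m) (sym (ℤ.*-identityˡ (g m)))) n)
  (trans (*-linearˡ 1ℤ g h f n) (cong (ℤ._+ (h * f) n) (ℤ.*-identityˡ ((g * f) n))))

*-distribˡ-⊕ : ∀ f g h → f * (g ⊕ h) ≈ f * g ⊕ f * h
*-distribˡ-⊕ f g h = begin
  f * (g ⊕ h)    ≈⟨ *-comm f (g ⊕ h) ⟩
  (g ⊕ h) * f    ≈⟨ *-distribʳ-⊕ f g h ⟩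
  g * f ⊕ h * f  ≈⟨ ⊕-cong (*-comm g f) (*-comm h f) ⟩
  f * g ⊕ f * h  ∎
  where open ≈-Reasoning

X^-*-assoc : ∀ n g → X ^ suc n * g ≈ X * (X ^ n * g)
X^-*-assoc n g = *-assoc X (X ^ n) g

*-𝟙 : ∀ g → g * 𝟙 ≈ g
*-𝟙 g n = trans (*-comm g 𝟙 n) (𝟙-* g n)

1-X-* : ∀ g n → ((𝟙 - X) * g) (suc n) ≡ g (suc n) ℤ.- g n
1-X-* g n = trans (*-distribʳ-- 𝟙 X g (suc n)) (cong₂ ℤ._-_ (𝟙-* g (suc n)) (X-*-suc g n))

-- Vectors of natural numbers counted by their sum

‖_‖ : {A : Set} → (ℕ → List A) → PowerSeries
‖ F ‖ = generatingSeries (λ k → length (F k))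

+-length-++ : ∀ {A : Set} (xs ys : List A) → ℤ.+ length (xs ++ ys) ≡ ℤ.+ length xs ℤ.+ ℤ.+ length ys
+-length-++ xs ys = cong ℤ.+_ (length-++ xs)

incrementHead : List ℕ → List ℕ
incrementHead []       = []
incrementHead (x ∷ xs) = suc x ∷ xs

-- The lists a ∷ u with u ∈ F j and a + j = k.
prepend : (ℕ → List (List ℕ)) → ℕ → List (List ℕ)
prepend F zero    = map (0 ∷_) (F 0)
prepend F (suc k) = map (0 ∷_) (F (suc k)) ++ map incrementHead (prepend F k)

∈-prepend⁺ : ∀ F a {u k} → u ∈ F k → a ∷ u ∈ prepend F (a + k)
∈-prepend⁺ F zero    {k = zero}  u∈F = ∈-map⁺ (0 ∷_) u∈F
∈-prepend⁺ F zero    {k = suc k} u∈F = ∈-++⁺ˡ (∈-map⁺ (0 ∷_) u∈F)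
∈-prepend⁺ F (suc a) {k = k}     u∈F =
  ∈-++⁺ʳ (map (0 ∷_) (F (suc (a + k)))) (∈-map⁺ incrementHead (∈-prepend⁺ F a u∈F))

∈-prepend⁻ : ∀ F k {g} → g ∈ prepend F k →
             ∃[ a ] ∃[ u ] ∃[ j ] g ≡ a ∷ u × u ∈ F j × a + j ≡ k
∈-prepend⁻ F zero g∈ with u , u∈F , refl ← ∈-map⁻ (0 ∷_) g∈ = 0 , u , 0 , refl , u∈F , refl
∈-prepend⁻ F (suc k) g∈ with ∈-++⁻ (map (0 ∷_) (F (suc k))) g∈
... | inj₁ g∈ˡ with u , u∈F , refl ← ∈-map⁻ (0 ∷_) g∈ˡ = 0 , u , suc k , refl , u∈F , refl
... | inj₂ g∈ʳ with v , v∈ , refl ← ∈-map⁻ incrementHead g∈ʳ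
               with a , u , j , refl , u∈F , refl ← ∈-prepend⁻ F k v∈ = suc a , u , j , refl , u∈F , refl

incrementHead-injective : ∀ {u v} → incrementHead u ≡ incrementHead v → u ≡ v
incrementHead-injective {[]}    {[]}    _    = refl
incrementHead-injective {_ ∷ _} {_ ∷ _} refl = refl

zeroHead-disjoint : ∀ {xs ys g} → g ∈ map (0 ∷_) xs → g ∈ map incrementHead ys → 0 ≡ 1
zeroHead-disjoint g∈ˡ g∈ʳ with ∈-map⁻ (0 ∷_) g∈ˡ | ∈-map⁻ incrementHead g∈ʳ
... | _ , _ , refl | []    , _ , ()
... | _ , _ , refl | _ ∷ _ , _ , ()

zeroHead-++-unique : ∀ {xs ys} → Unique xs → Unique ys →
                     Unique (map (0 ∷_) xs ++ map incrementHead ys)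
zeroHead-++-unique xs! ys! = Unique.++⁺
  (Unique.map⁺ ∷-injectiveʳ xs!) (Unique.map⁺ incrementHead-injective ys!)
  λ (∈ˡ , ∈ʳ) → ℕ.0≢1+n (zeroHead-disjoint ∈ˡ ∈ʳ)

prepend-unique : ∀ F → (∀ k → Unique (F k)) → ∀ k → Unique (prepend F k)
prepend-unique F F! zero    = Unique.map⁺ ∷-injectiveʳ (F! 0)
prepend-unique F F! (suc k) = zeroHead-++-unique (F! (suc k)) (prepend-unique F F! k)

-- By its recursion, P = `prepend F` has P(k + 1) as large as F(k + 1) and P(k) together, so a free
-- new head multiplies the series by 1 / (1 - X).
prepend-series : ∀ F → (𝟙 - X) * ‖ prepend F ‖ ≈ ‖ F ‖
prepend-series F zero = trans (ℤ.+-identityʳ _) (trans (ℤ.*-identityˡ (‖ prepend F ‖ 0)) (cong ℤ.+_ (length-map (0 ∷_) (F 0))))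
prepend-series F (suc k) = trans (1-X-* ‖ prepend F ‖ k)
  (trans (cong (ℤ._- p) (trans (+-length-++ (map (0 ∷_) (F (suc k))) _)
      (cong₂ (λ x y → ℤ.+ x ℤ.+ ℤ.+ y) (length-map (0 ∷_) (F (suc k))) (length-map incrementHead (prepend F k)))))
    (lemma (‖ F ‖ (suc k)) p))
  where
  p = ‖ prepend F ‖ k
  lemma : ∀ x y → x ℤ.+ y ℤ.- y ≡ x
  lemma = ℤ-Solver.solve-∀

vectors : ℕ → ℕ → List (List ℕ)
vectors zero    zero    = [] ∷ []
vectors zero    (suc k) = []
vectors (suc n)         = prepend (vectors n)

-- After a head 0 the tail is arbitrary; after a positive head the tail has to supply the zero.
-- Splitting by the head lists every vector only once.
zeroVectors : ℕ → ℕ → List (List ℕ)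
zeroVectors zero    _       = []
zeroVectors (suc n) zero    = map (0 ∷_) (vectors n 0)
zeroVectors (suc n) (suc k) = map (0 ∷_) (vectors n (suc k)) ++ map incrementHead (prepend (zeroVectors n) k)

∈-vectors⁺ : ∀ g → g ∈ vectors (length g) (sum g)
∈-vectors⁺ []      = here refl
∈-vectors⁺ (a ∷ u) = ∈-prepend⁺ (vectors (length u)) a (∈-vectors⁺ u)

∈-vectors⁻ : ∀ n k {g} → g ∈ vectors n k → length g ≡ n × sum g ≡ k
∈-vectors⁻ zero    zero (here refl) = refl , refl
∈-vectors⁻ (suc n) k    g∈ with a , u , j , refl , u∈ , refl ← ∈-prepend⁻ (vectors n) k g∈
                           with refl , refl ← ∈-vectors⁻ n j u∈ = refl , refl

∈-zeroVectors⁺ : ∀ g → 0 ∈ g → g ∈ zeroVectors (length g) (sum g)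
∈-zeroVectors⁺ (zero ∷ u) _ with sum u | ∈-vectors⁺ u
... | zero  | u∈ = ∈-map⁺ (0 ∷_) u∈
... | suc _ | u∈ = ∈-++⁺ˡ (∈-map⁺ (0 ∷_) u∈)
∈-zeroVectors⁺ (suc a ∷ u) (there 0∈u) = ∈-++⁺ʳ (map (0 ∷_) (vectors (length u) (suc (a + sum u))))
  (∈-map⁺ incrementHead (∈-prepend⁺ (zeroVectors (length u)) a (∈-zeroVectors⁺ u 0∈u)))

∈-zeroVectors⁻ : ∀ n k {g} → g ∈ zeroVectors n k → length g ≡ n × sum g ≡ k × 0 ∈ g
∈-zeroVectors⁻ (suc n) zero g∈ with u , u∈ , refl ← ∈-map⁻ (0 ∷_) g∈
                               with refl , sum≡0 ← ∈-vectors⁻ n 0 u∈ = refl , sum≡0 , here refl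
∈-zeroVectors⁻ (suc n) (suc k) g∈ with ∈-++⁻ (map (0 ∷_) (vectors n (suc k))) g∈
... | inj₁ g∈ˡ with u , u∈ , refl ← ∈-map⁻ (0 ∷_) g∈ˡ
               with refl , sum≡k ← ∈-vectors⁻ n (suc k) u∈ = refl , sum≡k , here refl
... | inj₂ g∈ʳ with v , v∈ , refl ← ∈-map⁻ incrementHead g∈ʳ
               with a , u , j , refl , u∈ , refl ← ∈-prepend⁻ (zeroVectors n) k v∈
               with refl , refl , 0∈u ← ∈-zeroVectors⁻ n j u∈ = refl , refl , there 0∈u

vectors-unique : ∀ n k → Unique (vectors n k)
vectors-unique zero    zero    = [] ∷ []
vectors-unique zero    (suc k) = []
vectors-unique (suc n) k       = prepend-unique (vectors n) (vectors-unique n) k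

zeroVectors-unique : ∀ n k → Unique (zeroVectors n k)
zeroVectors-unique zero    k       = []
zeroVectors-unique (suc n) zero    = Unique.map⁺ ∷-injectiveʳ (vectors-unique n 0)
zeroVectors-unique (suc n) (suc k) =
  zeroHead-++-unique (vectors-unique n (suc k)) (prepend-unique (zeroVectors n) (zeroVectors-unique n) k)

vectors-series : ∀ n → (𝟙 - X) ^ n * ‖ vectors n ‖ ≈ 𝟙
vectors-series zero    = λ { zero → refl ; (suc n) → trans (𝟙-* ‖ vectors 0 ‖ (suc n)) refl }
vectors-series (suc n) = begin
  ((𝟙 - X) * (𝟙 - X) ^ n) * ‖ vectors (suc n) ‖  ≈⟨ *-congʳ ‖ vectors (suc n) ‖ (*-comm (𝟙 - X) ((𝟙 - X) ^ n)) ⟩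
  ((𝟙 - X) ^ n * (𝟙 - X)) * ‖ vectors (suc n) ‖  ≈⟨ *-assoc ((𝟙 - X) ^ n) (𝟙 - X) ‖ vectors (suc n) ‖ ⟩
  (𝟙 - X) ^ n * ((𝟙 - X) * ‖ vectors (suc n) ‖)  ≈⟨ *-congˡ ((𝟙 - X) ^ n) (prepend-series (vectors n)) ⟩
  (𝟙 - X) ^ n * ‖ vectors n ‖                    ≈⟨ vectors-series n ⟩
  𝟙                                              ∎
  where open ≈-Reasoning

zeroVectors-recurrence : ∀ n → ‖ zeroVectors (suc n) ‖ ≈ ‖ vectors n ‖ ⊕ X * ‖ prepend (zeroVectors n) ‖
zeroVectors-recurrence n zero    = trans (cong ℤ.+_ (length-map (0 ∷_) (vectors n 0))) (sym (ℤ.+-identityʳ _))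
zeroVectors-recurrence n (suc k) = trans (+-length-++ (map (0 ∷_) (vectors n (suc k))) _)
  (cong₂ ℤ._+_ (cong ℤ.+_ (length-map (0 ∷_) (vectors n (suc k))))
    (trans (cong ℤ.+_ (length-map incrementHead (prepend (zeroVectors n) k))) (sym (X-*-suc ‖ prepend (zeroVectors n) ‖ k))))

-- Multiplied by (1 - X)^(n+1), the recurrence reads (1 - X) + X (1 - X^n), which telescopes.
zeroVectors-series : ∀ n → (𝟙 - X) ^ n * ‖ zeroVectors n ‖ ≈ 𝟙 - X ^ n
zeroVectors-series zero    = λ { zero → refl ; (suc n) → 𝟙-* ‖ zeroVectors 0 ‖ (suc n) }
zeroVectors-series (suc n) = begin
  (Y * A) * ‖ zeroVectors (suc n) ‖          ≈⟨ *-congˡ (Y * A) (zeroVectors-recurrence n) ⟩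
  (Y * A) * (V ⊕ X * P)                      ≈⟨ *-distribˡ-⊕ (Y * A) V (X * P) ⟩
  (Y * A) * V ⊕ (Y * A) * (X * P)            ≈⟨ ⊕-cong (*-assoc Y A V) (x∙yz≈y∙xz (Y * A) X P) ⟩
  Y * (A * V) ⊕ X * ((Y * A) * P)            ≈⟨ ⊕-cong (*-congˡ Y (vectors-series n)) (*-congˡ X (*-congʳ P (*-comm Y A))) ⟩
  Y * 𝟙 ⊕ X * ((A * Y) * P)                  ≈⟨ ⊕-cong (*-𝟙 Y) (*-congˡ X (*-assoc A Y P)) ⟩
  Y ⊕ X * (A * (Y * P))                      ≈⟨ ⊕-cong {Y} (λ _ → refl) (*-congˡ X (*-congˡ A (prepend-series (zeroVectors n)))) ⟩
  Y ⊕ X * (A * ‖ zeroVectors n ‖)            ≈⟨ ⊕-cong {Y} (λ _ → refl) (*-congˡ X (zeroVectors-series n)) ⟩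
  Y ⊕ X * (𝟙 - X ^ n)                        ≈⟨ ⊕-cong {Y} (λ _ → refl) (*-comm X (𝟙 - X ^ n)) ⟩
  Y ⊕ (𝟙 - X ^ n) * X                        ≈⟨ ⊕-cong {Y} (λ _ → refl) (*-distribʳ-- 𝟙 (X ^ n) X) ⟩
  Y ⊕ (𝟙 * X - X ^ n * X)                    ≈⟨ ⊕-cong {Y} (λ _ → refl) (λ k → cong₂ ℤ._-_ (𝟙-* X k) (*-comm (X ^ n) X k)) ⟩
  (𝟙 - X) ⊕ (X - X ^ suc n)                  ≈⟨ (λ k → telescope (𝟙 k) (X k) ((X ^ suc n) k)) ⟩
  𝟙 - X ^ suc n                              ∎
  where
  open ≈-Reasoning
  Y = 𝟙 - X
  A = (𝟙 - X) ^ n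
  V = ‖ vectors n ‖
  P = ‖ prepend (zeroVectors n) ‖
  telescope : ∀ x y z → (x ℤ.- y) ℤ.+ (y ℤ.- z) ≡ x ℤ.- z
  telescope = ℤ-Solver.solve-∀

-- Lists that solve a linear recurrence

delay : {A : Set} → ℕ → (ℕ → List A) → ℕ → List A
delay zero    F k       = F k
delay (suc n) F zero    = []
delay (suc n) F (suc k) = delay n F k

-- Only the index k - n is read, if it exists. The bound in the hypothesis allows approximations to
-- be exchanged that agree on small indices only.
delay-cong : ∀ {A : Set} n {F G : ℕ → List A} k → (∀ j → n + j ≤ k → F j ≡ G j) → delay n F k ≡ delay n G k
delay-cong zero    k       e = e k ℕ.≤-refl
delay-cong (suc n) zero    e = refl
delay-cong (suc n) (suc k) e = delay-cong n k λ j p → e j (s≤s p)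

∈-delay⁺ : ∀ {A : Set} n {F : ℕ → List A} {j a} → a ∈ F j → a ∈ delay n F (n + j)
∈-delay⁺ zero    a∈ = a∈
∈-delay⁺ (suc n) a∈ = ∈-delay⁺ n a∈

∈-delay⁻ : ∀ {A : Set} n {F : ℕ → List A} k {a} → a ∈ delay n F k → ∃[ j ] a ∈ F j × n + j ≡ k
∈-delay⁻ zero    k       a∈ = k , a∈ , refl
∈-delay⁻ (suc n) (suc k) a∈ with j , a∈F , refl ← ∈-delay⁻ n k a∈ = j , a∈F , refl

delay-unique : ∀ {A : Set} n {F : ℕ → List A} → (∀ j → Unique (F j)) → ∀ k → Unique (delay n F k)
delay-unique zero    F! k       = F! k
delay-unique (suc n) F! zero    = []
delay-unique (suc n) F! (suc k) = delay-unique n F! k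

delay-series : ∀ {A : Set} n (F : ℕ → List A) → ‖ delay n F ‖ ≈ X ^ n * ‖ F ‖
delay-series zero    F k       = sym (𝟙-* ‖ F ‖ k)
delay-series (suc n) F zero    = sym (X^-*-assoc n ‖ F ‖ 0)
delay-series (suc n) F (suc k) = trans (delay-series n F k)
  (sym (trans (X^-*-assoc n ‖ F ‖ (suc k)) (X-*-suc (X ^ n * ‖ F ‖) k)))

module Recurrence {A : Set} (base : ℕ → List A) (φ ψ : A → A) (t : ℕ) where

  private
    n = suc t

  -- The recurrence descends in k through `delay`, which is not structural recursion, so s bounds
  -- its depth. Each level lowers the index by at least n = t + 1, so s > k is deep enough and the
  -- value no longer depends on s.
  approximation : ℕ → ℕ → List A
  approximation zero    k = []
  approximation (suc s) k = base k ++ map φ (delay n (approximation s) k) ++ map ψ (delay (suc n) (approximation s) k)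

  solution : ℕ → List A
  solution k = approximation (suc k) k

  private
    below : ∀ m {j k} → suc m + j ≤ k → j < k
    below m {j} = ℕ.≤-trans (s≤s (ℕ.m≤n+m j m))

  approximation-stable : ∀ s s′ k → k < s → k < s′ → approximation s k ≡ approximation s′ k
  approximation-stable (suc s) (suc s′) k (s≤s k≤s) (s≤s k≤s′) = cong (base k ++_) (cong₂ (λ x y → map φ x ++ map ψ y)
    (delay-cong n       k λ j p → stable j (below t p))
    (delay-cong (suc n) k λ j p → stable j (below n p)))
    where
    stable : ∀ j → j < k → approximation s j ≡ approximation s′ j
    stable j j<k = approximation-stable s s′ j (ℕ.<-≤-trans j<k k≤s) (ℕ.<-≤-trans j<k k≤s′)

  solution-unfold : ∀ k → solution k ≡ base k ++ map φ (delay n solution k) ++ map ψ (delay (suc n) solution k)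
  solution-unfold k = cong (base k ++_) (cong₂ (λ x y → map φ x ++ map ψ y)
    (delay-cong n       k λ j p → approximation-stable k (suc j) j (below t p) ℕ.≤-refl)
    (delay-cong (suc n) k λ j p → approximation-stable k (suc j) j (below n p) ℕ.≤-refl))

  solution-recurrence : ‖ solution ‖ ≈ ‖ base ‖ ⊕ (X ^ n * ‖ solution ‖ ⊕ X ^ suc n * ‖ solution ‖)
  solution-recurrence k = trans (cong (ℤ.+_ ∘ length) (solution-unfold k))
    (trans (+-length-++ (base k) _) (cong (λ z → ‖ base ‖ k ℤ.+ z)
    (trans (+-length-++ (map φ (delay n solution k)) _) (cong₂ ℤ._+_
      (trans (cong ℤ.+_ (length-map φ (delay n solution k))) (delay-series n solution k))
      (trans (cong ℤ.+_ (length-map ψ (delay (suc n) solution k))) (delay-series (suc n) solution k))))))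

  solution-series : ‖ solution ‖ * (𝟙 - X ^ n - X ^ suc n) ≈ ‖ base ‖
  solution-series = begin
    S * (𝟙 - X ^ n - X ^ suc n)              ≈⟨ *-comm S _ ⟩
    (𝟙 - X ^ n - X ^ suc n) * S              ≈⟨ *-distribʳ-- (𝟙 - X ^ n) (X ^ suc n) S ⟩
    (𝟙 - X ^ n) * S - X ^ suc n * S          ≈⟨ (λ k → cong (ℤ._- (X ^ suc n * S) k) (*-distribʳ-- 𝟙 (X ^ n) S k)) ⟩
    𝟙 * S - X ^ n * S - X ^ suc n * S        ≈⟨ (λ k → cong (λ z → z ℤ.- (X ^ n * S) k ℤ.- (X ^ suc n * S) k)
                                                         (trans (𝟙-* S k) (solution-recurrence k))) ⟩
    ‖ base ‖ ⊕ (X ^ n * S ⊕ X ^ suc n * S) - X ^ n * S - X ^ suc n * S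
                                             ≈⟨ (λ k → cancel (‖ base ‖ k) ((X ^ n * S) k) ((X ^ suc n * S) k)) ⟩
    ‖ base ‖                                 ∎
    where
    open ≈-Reasoning
    S = ‖ solution ‖
    cancel : ∀ x y z → x ℤ.+ (y ℤ.+ z) ℤ.- y ℤ.- z ≡ x
    cancel = ℤ-Solver.solve-∀

-- Rim hooks

Antitone : (ℕ → ℕ) → Set
Antitone f = ∀ i → f (suc i) ≤ f i

antitone-≤ : ∀ {f} → Antitone f → ∀ {i j} → i ≤ j → f j ≤ f i
antitone-≤ f↓ {zero}  {zero}  _         = ℕ.≤-refl
antitone-≤ f↓ {zero}  {suc j} _         = ℕ.≤-trans (f↓ j) (antitone-≤ f↓ {j = j} z≤n)
antitone-≤ f↓ {suc i} {suc j} (s≤s i≤j) = antitone-≤ (f↓ ∘ suc) i≤j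

entry-antitone : ∀ {xs} → Linked _≥_ xs → Antitone (entry xs)
entry-antitone []          _       = z≤n
entry-antitone [-]         _       = z≤n
entry-antitone (x≥y ∷ _)   zero    = x≥y
entry-antitone (_ ∷ xs↓)   (suc i) = entry-antitone xs↓ i

-- For a partition with parts f, Hook ℓ f a m holds when an ℓ-rim hook with top row a
-- and bottom row a + m can be removed; it is horizontal exactly when m = 0.
Hook : ℕ → (ℕ → ℕ) → ℕ → ℕ → Set
Hook ℓ f a m = f (suc (a + m)) + ℓ ≤ f a + m × f a + m < f (a + m) + ℓ

HorizontalStep : ℕ → (ℕ → ℕ) → (ℕ → ℕ) → ℕ → Set
HorizontalStep ℓ f g a = g a + ℓ ≡ f a × (∀ i → i ≢ a → g i ≡ f i)

-- Equality of the contents j - i and j′ - i′, cleared of subtraction.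
SameDiagonal : Box → Box → Set
SameDiagonal (i , j) (i′ , j′) = i + j′ ≡ i′ + j

data NorthEast : Box → Box → Set where
  right : ∀ {i j} → NorthEast (i , j) (i , suc j)
  up    : ∀ {i j} → NorthEast (suc i , j) (i , j)

data SouthWest : Box → Box → Set where
  left : ∀ {i j} → SouthWest (i , suc j) (i , j)
  down : ∀ {i j} → SouthWest (i , j) (suc i , j)

direction : ∀ {x y} → Adjacent x y → NorthEast x y ⊎ SouthWest x y
direction right = inj₁ right
direction up    = inj₁ up
direction left  = inj₂ left
direction down  = inj₂ down

-- A north-east step raises the content by 1 and a south-west step lowers it by 1, so turning back
-- returns to the same diagonal.
ne-sw : ∀ {x y z} → NorthEast x y → SouthWest y z → SameDiagonal x z
ne-sw right         left         = refl
ne-sw (right {i} {j}) down       = ℕ.+-suc i j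
ne-sw (up {i})      (left {j = j}) = sym (ℕ.+-suc i j)
ne-sw up            down         = refl

sw-ne : ∀ {x y z} → SouthWest x y → NorthEast y z → SameDiagonal x z
sw-ne left          right          = refl
sw-ne (left {j = j}) (up {i})      = sym (ℕ.+-suc i j)
sw-ne (down {i} {j}) right         = ℕ.+-suc i j
sw-ne down          up             = refl

-- A path that meets every diagonal at most once never turns back.
ne-path : ∀ {x y bs} → AllPairs (λ b c → ¬ SameDiagonal b c) (x ∷ y ∷ bs) →
          NorthEast x y → Linked Adjacent (y ∷ bs) → Linked NorthEast (x ∷ y ∷ bs)
ne-path _ x↗y [-] = x↗y ∷ [-]
ne-path ((_ ∷ x≁z ∷ _) ∷ ≁s) x↗y (y~z ∷ zs) with direction y~z
... | inj₁ y↗z = x↗y ∷ ne-path ≁s y↗z zs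
... | inj₂ y↙z = contradiction (ne-sw x↗y y↙z) x≁z

sw-path : ∀ {x y bs} → AllPairs (λ b c → ¬ SameDiagonal b c) (x ∷ y ∷ bs) →
          SouthWest x y → Linked Adjacent (y ∷ bs) → Linked SouthWest (x ∷ y ∷ bs)
sw-path _ x↙y [-] = x↙y ∷ [-]
sw-path ((_ ∷ x≁z ∷ _) ∷ ≁s) x↙y (y~z ∷ zs) with direction y~z
... | inj₁ y↗z = contradiction (sw-ne x↙y y↗z) x≁z
... | inj₂ y↙z = x↙y ∷ sw-path ≁s y↙z zs

row col : Box → ℕ
row = proj₁
col = proj₂

-- The two extremal boxes of a monotone path. `extent` says that its length is one more than the sum
-- of its width and height in steps, cleared of subtraction.
record Ends (bs : List Box) (sw ne : Box) : Set where
  constructor ends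
  field
    sw∈    : sw ∈ bs
    ne∈    : ne ∈ bs
    row-≥  : All (λ b → row ne ≤ row b) bs
    row-≤  : All (λ b → row b ≤ row sw) bs
    col-≥  : All (λ b → col sw ≤ col b) bs
    col-≤  : All (λ b → col b ≤ col ne) bs
    extent : length bs + col sw + row ne ≡ suc (col ne + row sw)

singleton-ends : ∀ b → Ends (b ∷ []) b b
singleton-ends (i , j) = ends (here refl) (here refl) (ℕ.≤-refl ∷ []) (ℕ.≤-refl ∷ []) (ℕ.≤-refl ∷ []) (ℕ.≤-refl ∷ []) refl

ne-ends : ∀ {x bs} → Linked NorthEast (x ∷ bs) → ∃[ e ] Ends (x ∷ bs) x e
ne-ends {x} [-] = x , singleton-ends x
ne-ends {i , j} {bs} (right ∷ p) with e , ends s∈ e∈ r≥ r≤ c≥ c≤ eq ← ne-ends p =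
  e , ends (here refl) (there e∈) (All.head r≥ ∷ r≥) (ℕ.≤-refl ∷ r≤)
    (ℕ.≤-refl ∷ All.map (ℕ.≤-trans (ℕ.n≤1+n j)) c≥) (ℕ.≤-trans (ℕ.n≤1+n j) (All.head c≤) ∷ c≤)
    (trans (cong (_+ row e) (sym (ℕ.+-suc (length bs) j))) eq)
ne-ends (up {i} {j} ∷ p) with e , ends s∈ e∈ r≥ r≤ c≥ c≤ eq ← ne-ends p =
  e , ends (here refl) (there e∈) (ℕ.≤-trans (All.head r≥) (ℕ.n≤1+n i) ∷ r≥) (ℕ.≤-refl ∷ All.map (λ q → ℕ.≤-trans q (ℕ.n≤1+n i)) r≤)
    (ℕ.≤-refl ∷ c≥) (All.head c≤ ∷ c≤)
    (cong suc (trans eq (sym (ℕ.+-suc (col e) i))))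

sw-ends : ∀ {x bs} → Linked SouthWest (x ∷ bs) → ∃[ s ] Ends (x ∷ bs) s x
sw-ends {x} [-] = x , singleton-ends x
sw-ends (left {i} {j} ∷ p) with s , ends s∈ e∈ r≥ r≤ c≥ c≤ eq ← sw-ends p =
  s , ends (there s∈) (here refl) (ℕ.≤-refl ∷ r≥) (All.head r≤ ∷ r≤)
    (ℕ.≤-trans (All.head c≥) (ℕ.n≤1+n j) ∷ c≥) (ℕ.≤-refl ∷ All.map (λ q → ℕ.≤-trans q (ℕ.n≤1+n j)) c≤)
    (cong suc eq)
sw-ends {i , j} {bs} (down ∷ p) with s , ends s∈ e∈ r≥ r≤ c≥ c≤ eq ← sw-ends p =
  s , ends (there s∈) (here refl) (ℕ.≤-refl ∷ All.map (ℕ.≤-trans (ℕ.n≤1+n i)) r≥) (ℕ.≤-trans (ℕ.n≤1+n i) (All.head r≤) ∷ r≤)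
    (All.head c≥ ∷ c≥) (ℕ.≤-refl ∷ c≤)
    (trans (sym (ℕ.+-suc (length bs + col s) i)) eq)

path-ends : ∀ {x bs} → AllPairs (λ b c → ¬ SameDiagonal b c) (x ∷ bs) → Linked Adjacent (x ∷ bs) →
            ∃[ s ] ∃[ e ] Ends (x ∷ bs) s e
path-ends {x} _ [-] = x , x , singleton-ends x
path-ends {x} ≁s (x~y ∷ p) with direction x~y
... | inj₁ x↗y = x , ne-ends (ne-path ≁s x↗y p)
... | inj₂ x↙y with s , es ← sw-ends (sw-path ≁s x↙y p) = s , x , es

_∈?_ = DecMembership._∈?_ (≡-dec ℕ._≟_ ℕ._≟_)

allPairs-∈ : ∀ {A : Set} {R S : A → A → Set} {xs : List A} →
             (∀ {x y} → x ∈ xs → y ∈ xs → R x y → S x y) → AllPairs R xs → AllPairs S xs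
allPairs-∈ f []         = []
allPairs-∈ f (rs ∷ rss) =
  All.tabulate (λ y∈ → f (here refl) (there y∈) (All.lookup rs y∈)) ∷
  allPairs-∈ (λ x∈ y∈ → f (there x∈) (there y∈)) rss

module FromRimHook {ℓ α β} (h : RimHook ℓ α β) where

  private
    f = entry (parts α)
    g = entry (parts β)
    f↓ = entry-antitone (decreasing α)
    g↓ = entry-antitone (decreasing β)

  -- The field `removal` yields membership in the hook only up to a double negation, which decidable
  -- equality of boxes removes.
  ∈-boxes : ∀ {i j} → j < f i → g i ≤ j → (i , j) ∈ boxes h
  ∈-boxes {i} {j} j<fi gi≤j = decidable-stable ((i , j) ∈? boxes h) λ b∉ →
    ℕ.<⇒≱ (Equivalence.from (removal h (i , j)) (j<fi , b∉)) gi≤j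

  boxes-inside : ∀ {i j} → (i , j) ∈ boxes h → j < f i
  boxes-inside = All.lookup (inside h)

  boxes-outside : ∀ {i j} → (i , j) ∈ boxes h → g i ≤ j
  boxes-outside {i} {j} b∈ = ℕ.≮⇒≥ λ j<gi → proj₂ (Equivalence.to (removal h (i , j)) j<gi) b∈

  g≤f : ∀ i → g i ≤ f i
  g≤f i = ℕ.≮⇒≥ λ fi<gi → ℕ.<-irrefl refl (proj₁ (Equivalence.to (removal h (i , f i)) fi<gi))

  -- The box (i + 1 , j + 1) lies weakly north-west of (i′ , j′), hence in α, and (i , j) is not in
  -- β. So the whole square with corner (i , j) lies in α and outside β, that is, in the hook.
  diagonal-< : ∀ {i j i′ j′} → i < i′ → (i , j) ∈ boxes h → (i′ , j′) ∈ boxes h → ¬ SameDiagonal (i , j) (i′ , j′)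
  diagonal-< {i} {j} {i′} {j′} i<i′ b∈ b′∈ eq = noSquare h
    (i , j , b∈ , ∈-boxes (ℕ.<-≤-trans 1+j<f (f↓ i)) (ℕ.m≤n⇒m≤1+n g≤j)
                , ∈-boxes (ℕ.<-trans (ℕ.n<1+n j) 1+j<f) (ℕ.≤-trans (g↓ i) g≤j)
                , ∈-boxes 1+j<f (ℕ.≤-trans (g↓ i) (ℕ.m≤n⇒m≤1+n g≤j)))
    where
    g≤j = boxes-outside b∈
    j<j′ : j < j′
    j<j′ = ℕ.≰⇒> λ j′≤j → ℕ.<-irrefl eq (ℕ.+-mono-<-≤ i<i′ j′≤j)
    1+j<f : suc j < f (suc i)
    1+j<f = ℕ.≤-<-trans j<j′ (ℕ.<-≤-trans (boxes-inside b′∈) (antitone-≤ f↓ i<i′))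

  diagonal-injective : ∀ {b c} → b ∈ boxes h → c ∈ boxes h → b ≢ c → ¬ SameDiagonal b c
  diagonal-injective {i , j} {i′ , j′} b∈ c∈ b≢c eq with ℕ.<-cmp i i′
  ... | tri< i<i′ _ _    = diagonal-< i<i′ b∈ c∈ eq
  ... | tri≈ _ refl _    = b≢c (cong (i ,_) (sym (ℕ.+-cancelˡ-≡ i j′ j eq)))
  ... | tri> _ _ i′<i    = diagonal-< i′<i c∈ b∈ (sym eq)

  boxes-ends : 0 < ℓ → ∃[ s ] ∃[ e ] Ends (boxes h) s e
  boxes-ends 0<ℓ = nonempty (boxes h) (subst (0 <_) (sym (size h)) 0<ℓ)
    (allPairs-∈ diagonal-injective (distinct h)) (connected h)
    where
    nonempty : ∀ bs → 0 < length bs → AllPairs (λ b c → ¬ SameDiagonal b c) bs → Linked Adjacent bs →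
               ∃[ s ] ∃[ e ] Ends bs s e
    nonempty (_ ∷ _) _ = path-ends

  module _ {s e} (es : Ends (boxes h) s e) where
    open Ends es

    private
      a = row e
      b = row s

    -- The last box of row a is outside β because `e`, weakly to its left, is. So it belongs to the
    -- hook and cannot lie east of `e`.
    col-ne : suc (col e) ≡ f a
    col-ne = ℕ.≤-antisym (boxes-inside ne∈) (last (f a) refl)
      where
      last : ∀ k → k ≡ f a → k ≤ suc (col e)
      last zero    _  = z≤n
      last (suc k) eq = s≤s (ℕ.≮⇒≥ λ e<k → ℕ.<⇒≱ e<k (All.lookup col-≤
        (∈-boxes (ℕ.≤-reflexive eq) (ℕ.≤-trans (boxes-outside ne∈) (ℕ.<⇒≤ e<k)))))

    col-sw : col s ≡ g b
    col-sw = ℕ.≤-antisym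
      (All.lookup col-≥ (∈-boxes (ℕ.≤-<-trans (boxes-outside sw∈) (boxes-inside sw∈)) ℕ.≤-refl))
      (boxes-outside sw∈)

    -- This is `extent` with its coordinates identified; g b is what the bottom row keeps.
    hook-size : f a + (b ∸ a) ≡ g b + ℓ
    hook-size = ℕ.+-cancelʳ-≡ a _ _ (begin
      f a + (b ∸ a) + a              ≡⟨ ℕ.+-assoc (f a) (b ∸ a) a ⟩
      f a + (b ∸ a + a)              ≡⟨ cong (f a +_) (ℕ.m∸n+n≡m (All.lookup row-≥ sw∈)) ⟩
      f a + b                        ≡⟨ cong (_+ b) col-ne ⟨
      suc (col e + b)                ≡⟨ extent ⟨
      length (boxes h) + col s + a   ≡⟨ cong₂ (λ x y → x + y + a) (size h) col-sw ⟩
      ℓ + g b + a                    ≡⟨ cong (_+ a) (ℕ.+-comm ℓ (g b)) ⟩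
      g b + ℓ + a                    ∎)
      where open ≡-Reasoning

    -- Otherwise the box (b + 1 , g b) would belong to the hook, below its lowest row.
    below : f (suc b) ≤ g b
    below = ℕ.≮⇒≥ λ gb<f → ℕ.1+n≰n (All.lookup row-≤ (∈-boxes gb<f (g↓ b)))

    a+[b∸a]≡b : a + (b ∸ a) ≡ b
    a+[b∸a]≡b = ℕ.m+[n∸m]≡n (All.lookup row-≥ sw∈)

    hook : Hook ℓ f a (b ∸ a)
    hook = subst (λ z → f (suc z) + ℓ ≤ f a + (b ∸ a)) (sym a+[b∸a]≡b)
             (subst (f (suc b) + ℓ ≤_) (sym hook-size) (ℕ.+-monoˡ-≤ ℓ below))
         , subst (λ z → f a + (b ∸ a) < f z + ℓ) (sym a+[b∸a]≡b)
             (subst (_< f b + ℓ) (sym hook-size)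
               (ℕ.+-monoˡ-< ℓ (ℕ.≤-<-trans (boxes-outside sw∈) (boxes-inside sw∈))))

    one-row : a ≡ b → Horizontal h
    one-row a≡b = a , All.tabulate λ c∈ →
      ℕ.≤-antisym (subst (_ ≤_) (sym a≡b) (All.lookup row-≤ c∈)) (All.lookup row-≥ c∈)

  nonHorizontal⇒hook : 0 < ℓ → ¬ Horizontal h → ∃[ a ] ∃[ m ] Hook ℓ f a (suc m)
  nonHorizontal⇒hook 0<ℓ ¬hor with s , e , es ← boxes-ends 0<ℓ = row e , split (row s ∸ row e) refl (hook es)
    where
    split : ∀ m → m ≡ row s ∸ row e → Hook ℓ f (row e) m → ∃[ m ] Hook ℓ f (row e) (suc m)
    split (suc m) _  hk = m , hk
    split zero    eq _  = contradiction
      (one-row es (trans (sym (ℕ.+-identityʳ (row e))) (trans (cong (row e +_) eq) (a+[b∸a]≡b es)))) ¬hor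

  horizontal⇒step : 0 < ℓ → Horizontal h → ∃[ a ] HorizontalStep ℓ f g a
  horizontal⇒step 0<ℓ (i , inRow) with s , e , es ← boxes-ends 0<ℓ = i
    , trans (sym (subst₂ (λ x y → f x + (y ∸ x) ≡ g y + ℓ) e≡i s≡i (hook-size es)))
            (trans (cong (f i +_) (ℕ.n∸n≡0 i)) (ℕ.+-identityʳ (f i)))
    , λ j j≢i → ℕ.≤-antisym (g≤f j) (ℕ.≮⇒≥ λ gj<fj → j≢i (All.lookup inRow (∈-boxes gj<fj ℕ.≤-refl)))
    where
    e≡i = All.lookup inRow (Ends.ne∈ es)
    s≡i = All.lookup inRow (Ends.sw∈ es)

-- Construction of rim hooks, row by row from the north-east end

leftwards : ℕ → ℕ → ℕ → List Box → List Box
leftwards i lo zero    bs = (i , lo) ∷ bs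
leftwards i lo (suc c) bs = (i , suc c + lo) ∷ leftwards i lo c bs

∈-leftwards⁺ˡ : ∀ {i lo} c {bs j} → lo ≤ j → j ≤ c + lo → (i , j) ∈ leftwards i lo c bs
∈-leftwards⁺ˡ zero    lo≤j j≤ = here (cong (_ ,_) (ℕ.≤-antisym j≤ lo≤j))
∈-leftwards⁺ˡ (suc c) lo≤j j≤ with ℕ.m≤n⇒m<n∨m≡n j≤
... | inj₁ j<   = there (∈-leftwards⁺ˡ c lo≤j (s≤s⁻¹ j<))
... | inj₂ refl = here refl

∈-leftwards⁺ʳ : ∀ {i lo} c {bs b} → b ∈ bs → b ∈ leftwards i lo c bs
∈-leftwards⁺ʳ zero    b∈ = there b∈
∈-leftwards⁺ʳ (suc c) b∈ = there (∈-leftwards⁺ʳ c b∈)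

∈-leftwards⁻ : ∀ {i lo} c {bs x y} → (x , y) ∈ leftwards i lo c bs →
               (x ≡ i × lo ≤ y × y ≤ c + lo) ⊎ (x , y) ∈ bs
∈-leftwards⁻ zero    (here refl) = inj₁ (refl , ℕ.≤-refl , ℕ.≤-refl)
∈-leftwards⁻ zero    (there b∈)  = inj₂ b∈
∈-leftwards⁻ {lo = lo} (suc c) (here refl) = inj₁ (refl , ℕ.m≤n+m lo (suc c) , ℕ.≤-refl)
∈-leftwards⁻ (suc c) (there b∈) with ∈-leftwards⁻ c b∈
... | inj₁ (x≡i , lo≤y , y≤) = inj₁ (x≡i , lo≤y , ℕ.m≤n⇒m≤1+n y≤)
... | inj₂ b∈bs              = inj₂ b∈bs

length-leftwards : ∀ i lo c bs → length (leftwards i lo c bs) ≡ suc c + length bs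
length-leftwards i lo zero    bs = refl
length-leftwards i lo (suc c) bs = cong suc (length-leftwards i lo c bs)

∷-leftwards : ∀ {x i lo} c {bs} → Adjacent x (i , c + lo) →
              Linked Adjacent (leftwards i lo c bs) → Linked Adjacent (x ∷ leftwards i lo c bs)
∷-leftwards zero    x~ p = x~ ∷ p
∷-leftwards (suc c) x~ p = x~ ∷ p

leftwards-linked : ∀ {i lo} c {bs} → Linked Adjacent ((i , lo) ∷ bs) → Linked Adjacent (leftwards i lo c bs)
leftwards-linked zero    p = p
leftwards-linked (suc c) p = ∷-leftwards c left (leftwards-linked c p)

leftwards-unique : ∀ {i lo} c {bs} → (∀ {y} → (i , y) ∉ bs) → Unique bs → Unique (leftwards i lo c bs)
leftwards-unique {i} {lo} zero i∉ bs! = All.tabulate (λ { b∈ refl → i∉ b∈ }) ∷ bs!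
leftwards-unique {i} {lo} (suc c) {bs} i∉ bs! = All.tabulate fresh ∷ leftwards-unique c i∉ bs!
  where
  fresh : ∀ {b} → b ∈ leftwards i lo c bs → (i , suc c + lo) ≢ b
  fresh b∈ refl with ∈-leftwards⁻ c b∈
  ... | inj₁ (_ , _ , y≤) = ℕ.1+n≰n y≤
  ... | inj₂ b∈bs         = i∉ b∈bs

-- The skew shape f / g restricted to rows a, …, b = a + m is a ribbon.
data Ribbon (f g : ℕ → ℕ) : ℕ → ℕ → ℕ → Set where
  end  : ∀ {a} c → f a ≡ suc (c + g a) → Ribbon f g a a 0
  step : ∀ {a b m} c → f a ≡ suc (c + g a) → f (suc a) ≡ suc (g a) →
         Ribbon f g (suc a) b m → Ribbon f g a b (suc m)

module _ {f g : ℕ → ℕ} where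

  ribbonBoxes : ∀ {a b m} → Ribbon f g a b m → List Box
  ribbonBoxes {a} (end c _)      = leftwards a (g a) c []
  ribbonBoxes {a} (step c _ _ r) = leftwards a (g a) c (ribbonBoxes r)

  ribbon-≤ : ∀ {a b m} → Ribbon f g a b m → a ≤ b
  ribbon-≤ (end _ _)      = ℕ.≤-refl
  ribbon-≤ (step _ _ _ r) = ℕ.<⇒≤ (ribbon-≤ r)

  ribbon-shrinks : ∀ {a b m} → Ribbon f g a b m → ∀ {i} → a ≤ i → i ≤ b → g i < f i
  ribbon-shrinks (end {a} c eq) a≤i i≤b with refl ← ℕ.≤-antisym a≤i i≤b =
    subst (g a <_) (sym eq) (s≤s (ℕ.m≤n+m (g a) c))
  ribbon-shrinks (step {a} c eq _ r) a≤i i≤b with ℕ.m≤n⇒m<n∨m≡n a≤i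
  ... | inj₁ a<i  = ribbon-shrinks r a<i i≤b
  ... | inj₂ refl = subst (g a <_) (sym eq) (s≤s (ℕ.m≤n+m (g a) c))

  -- Consecutive rows of the ribbon share exactly the column g i. This both connects them and rules
  -- out squares.
  ribbon-overlap : ∀ {a b m} → Ribbon f g a b m → ∀ {i} → a ≤ i → i < b → f (suc i) ≡ suc (g i)
  ribbon-overlap (end _ _) a≤i i<b = contradiction a≤i (ℕ.<⇒≱ i<b)
  ribbon-overlap (step _ _ eq r) a≤i i<b with ℕ.m≤n⇒m<n∨m≡n a≤i
  ... | inj₁ a<i  = ribbon-overlap r a<i i<b
  ... | inj₂ refl = eq

  ∈-ribbon⁺ : ∀ {a b m} (r : Ribbon f g a b m) {i j} → a ≤ i → i ≤ b → g i ≤ j → j < f i → (i , j) ∈ ribbonBoxes r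
  ∈-ribbon⁺ (end c eq) a≤i i≤b g≤j j<f with refl ← ℕ.≤-antisym a≤i i≤b =
    ∈-leftwards⁺ˡ c g≤j (s≤s⁻¹ (subst (_ <_) eq j<f))
  ∈-ribbon⁺ (step c eq _ r) a≤i i≤b g≤j j<f with ℕ.m≤n⇒m<n∨m≡n a≤i
  ... | inj₁ a<i  = ∈-leftwards⁺ʳ c (∈-ribbon⁺ r a<i i≤b g≤j j<f)
  ... | inj₂ refl = ∈-leftwards⁺ˡ c g≤j (s≤s⁻¹ (subst (_ <_) eq j<f))

  ∈-ribbon⁻ : ∀ {a b m} (r : Ribbon f g a b m) {i j} → (i , j) ∈ ribbonBoxes r → a ≤ i × i ≤ b × g i ≤ j × j < f i
  ∈-ribbon⁻ (end c eq) b∈ with ∈-leftwards⁻ c b∈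
  ... | inj₁ (refl , g≤j , j≤) = ℕ.≤-refl , ℕ.≤-refl , g≤j , subst (_ <_) (sym eq) (s≤s j≤)
  ∈-ribbon⁻ (step c eq _ r) b∈ with ∈-leftwards⁻ c b∈
  ... | inj₁ (refl , g≤j , j≤) = ℕ.≤-refl , ℕ.<⇒≤ (ribbon-≤ r) , g≤j , subst (_ <_) (sym eq) (s≤s j≤)
  ... | inj₂ b∈r with a<i , i≤b , g≤j , j<f ← ∈-ribbon⁻ r b∈r = ℕ.<⇒≤ a<i , i≤b , g≤j , j<f

  -- A telescoping sum: each row above the last contributes f a - g a = f a - f (a + 1) + 1.
  length-ribbonBoxes : ∀ {a b m} (r : Ribbon f g a b m) → length (ribbonBoxes r) + g b ≡ f a + m
  length-ribbonBoxes (end {a} c eq) = begin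
    length (leftwards a (g a) c []) + g a  ≡⟨ cong (_+ g a) (length-leftwards a (g a) c []) ⟩
    suc c + 0 + g a                        ≡⟨ cong (_+ g a) (ℕ.+-identityʳ (suc c)) ⟩
    suc c + g a                            ≡⟨ eq ⟨
    f a                                    ≡⟨ ℕ.+-identityʳ (f a) ⟨
    f a + 0                                ∎
    where open ≡-Reasoning
  length-ribbonBoxes (step {a} {b} {m} c eq eq′ r) = begin
    length (leftwards a (g a) c (ribbonBoxes r)) + g b  ≡⟨ cong (_+ g b) (length-leftwards a (g a) c (ribbonBoxes r)) ⟩
    suc c + length (ribbonBoxes r) + g b                ≡⟨ ℕ.+-assoc (suc c) (length (ribbonBoxes r)) (g b) ⟩
    suc c + (length (ribbonBoxes r) + g b)              ≡⟨ cong (suc c +_) (length-ribbonBoxes r) ⟩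
    suc c + (f (suc a) + m)                             ≡⟨ cong (λ z → suc c + (z + m)) eq′ ⟩
    suc c + suc (g a + m)                               ≡⟨ cong (suc c +_) (sym (ℕ.+-suc (g a) m)) ⟩
    suc c + (g a + suc m)                               ≡⟨ ℕ.+-assoc (suc c) (g a) (suc m) ⟨
    suc c + g a + suc m                                 ≡⟨ cong (_+ suc m) eq ⟨
    f a + suc m                                         ∎
    where open ≡-Reasoning

  ∷-ribbonBoxes : ∀ {a b m} (r : Ribbon f g a b m) {x} → (∀ {j} → f a ≡ suc j → Adjacent x (a , j)) →
                  Linked Adjacent (ribbonBoxes r) → Linked Adjacent (x ∷ ribbonBoxes r)
  ∷-ribbonBoxes (end c eq)      x~ p = ∷-leftwards c (x~ eq) p
  ∷-ribbonBoxes (step c eq _ r) x~ p = ∷-leftwards c (x~ eq) p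

  ribbonBoxes-linked : ∀ {a b m} (r : Ribbon f g a b m) → Linked Adjacent (ribbonBoxes r)
  ribbonBoxes-linked (end c _)         = leftwards-linked c [-]
  ribbonBoxes-linked (step {a} c _ eq r) = leftwards-linked c (∷-ribbonBoxes r downwards (ribbonBoxes-linked r))
    where
    downwards : ∀ {j} → f (suc a) ≡ suc j → Adjacent (a , g a) (suc a , j)
    downwards eq′ with refl ← ℕ.suc-injective (trans (sym eq) eq′) = down

  ribbonBoxes-unique : ∀ {a b m} (r : Ribbon f g a b m) → Unique (ribbonBoxes r)
  ribbonBoxes-unique (end c _)      = leftwards-unique c (λ ()) []
  ribbonBoxes-unique (step c _ _ r) =
    leftwards-unique c (λ b∈ → ℕ.1+n≰n (proj₁ (∈-ribbon⁻ r b∈))) (ribbonBoxes-unique r)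

module FromRibbon {ℓ} α β {a b m} (r : Ribbon (entry (parts α)) (entry (parts β)) a b m)
  (outside : ∀ i → i < a ⊎ b < i → entry (parts β) i ≡ entry (parts α) i)
  (ℓ-size : entry (parts α) a + m ≡ entry (parts β) b + ℓ) where

  private
    f = entry (parts α)
    g = entry (parts β)

  ribbonHook : RimHook ℓ α β
  ribbonHook = record
    { boxes     = ribbonBoxes r
    ; size      = ℕ.+-cancelʳ-≡ (g b) _ _ (trans (length-ribbonBoxes r) (trans ℓ-size (ℕ.+-comm (g b) ℓ)))
    ; distinct  = ribbonBoxes-unique r
    ; inside    = All.tabulate λ b∈ → proj₂ (proj₂ (proj₂ (∈-ribbon⁻ r b∈)))
    ; connected = ribbonBoxes-linked r
    -- A square would need j ≥ g i and j + 1 < f (i + 1) = g i + 1.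
    ; noSquare  = λ (i , j , ∈₀₀ , _ , _ , ∈₁₁) →
        let a≤i , _ , g≤j , _    = ∈-ribbon⁻ r ∈₀₀
            _ , i<b , _ , 1+j<f  = ∈-ribbon⁻ r ∈₁₁
        in ℕ.<⇒≱ (s≤s⁻¹ (subst (suc j <_) (ribbon-overlap r a≤i i<b) 1+j<f)) g≤j
    ; removal   = λ (i , j) → mk⇔ (to i j) (from i j)
    }
    where
    region : ∀ i → (i < a ⊎ b < i) ⊎ (a ≤ i × i ≤ b)
    region i with i ℕ.<? a | b ℕ.<? i
    ... | yes i<a | _       = inj₁ (inj₁ i<a)
    ... | no _    | yes b<i = inj₁ (inj₂ b<i)
    ... | no i≮a  | no b≮i  = inj₂ (ℕ.≮⇒≥ i≮a , ℕ.≮⇒≥ b≮i)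
    to : ∀ i j → j < g i → j < f i × (i , j) ∉ ribbonBoxes r
    to i j j<g with region i
    ... | inj₁ out         = subst (j <_) (outside i out) j<g , λ b∈ → ℕ.<⇒≱ j<g (proj₁ (proj₂ (proj₂ (∈-ribbon⁻ r b∈))))
    ... | inj₂ (a≤i , i≤b) = ℕ.<-trans j<g (ribbon-shrinks r a≤i i≤b) , λ b∈ → ℕ.<⇒≱ j<g (proj₁ (proj₂ (proj₂ (∈-ribbon⁻ r b∈))))
    from : ∀ i j → j < f i × (i , j) ∉ ribbonBoxes r → j < g i
    from i j (j<f , b∉) with region i
    ... | inj₁ out         = subst (j <_) (sym (outside i out)) j<f
    ... | inj₂ (a≤i , i≤b) = ℕ.≰⇒> λ g≤j → b∉ (∈-ribbon⁺ r a≤i i≤b g≤j j<f)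

  ribbonHook-horizontal : a ≡ b → Horizontal ribbonHook
  ribbonHook-horizontal a≡b = a , All.tabulate λ b∈ → let a≤i , i≤b , _ = ∈-ribbon⁻ r b∈ in
    ℕ.≤-antisym (subst (_ ≤_) (sym a≡b) i≤b) a≤i

  ribbonHook-nonHorizontal : a < b → ¬ Horizontal ribbonHook
  ribbonHook-nonHorizontal a<b (i , inRow) = ℕ.<⇒≢ a<b (trans
    (All.lookup inRow (∈-ribbon⁺ r ℕ.≤-refl (ℕ.<⇒≤ a<b) ℕ.≤-refl (ribbon-shrinks r ℕ.≤-refl (ℕ.<⇒≤ a<b))))
    (sym (All.lookup inRow (∈-ribbon⁺ r (ℕ.<⇒≤ a<b) ℕ.≤-refl ℕ.≤-refl (ribbon-shrinks r (ℕ.<⇒≤ a<b) ℕ.≤-refl)))))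

-- The parts left after removing a rim hook with top row a and bottom row a + m,
-- whose bottom row keeps v boxes.
remaining : (ℕ → ℕ) → ℕ → ℕ → ℕ → (ℕ → ℕ)
remaining f (suc a) m       v zero    = f 0
remaining f (suc a) m       v (suc i) = remaining (f ∘ suc) a m v i
remaining f zero    zero    v zero    = v
remaining f zero    zero    v (suc i) = f (suc i)
remaining f zero    (suc m) v zero    = pred (f 1)
remaining f zero    (suc m) v (suc i) = remaining (f ∘ suc) 0 m v i

remaining-≤ : ∀ {f} → Antitone f → ∀ a m {v} → v < f (a + m) → ∀ i → remaining f a m v i ≤ f i
remaining-≤ f↓ (suc a) m       v< zero    = ℕ.≤-refl
remaining-≤ f↓ (suc a) m       v< (suc i) = remaining-≤ (f↓ ∘ suc) a m v< i
remaining-≤ f↓ zero    zero    v< zero    = ℕ.<⇒≤ v<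
remaining-≤ f↓ zero    zero    v< (suc i) = ℕ.≤-refl
remaining-≤ f↓ zero    (suc m) v< zero    = ℕ.≤-trans ℕ.pred[n]≤n (f↓ 0)
remaining-≤ f↓ zero    (suc m) v< (suc i) = remaining-≤ (f↓ ∘ suc) 0 m v< i

remaining-≤-pred : ∀ {f} → Antitone f → ∀ m {v} → v < f m → remaining f 0 m v 0 ≤ pred (f 0)
remaining-≤-pred f↓ zero    v< = ℕ.<⇒≤pred v<
remaining-≤-pred f↓ (suc m) v< = ℕ.pred-mono-≤ (f↓ 0)

remaining-antitone : ∀ {f} → Antitone f → ∀ a m {v} → f (suc (a + m)) ≤ v → v < f (a + m) →
                     Antitone (remaining f a m v)
remaining-antitone f↓ (suc a) m       ≤v v< zero    = ℕ.≤-trans (remaining-≤ (f↓ ∘ suc) a m v< 0) (f↓ 0)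
remaining-antitone f↓ (suc a) m       ≤v v< (suc i) = remaining-antitone (f↓ ∘ suc) a m ≤v v< i
remaining-antitone f↓ zero    zero    ≤v v< zero    = ≤v
remaining-antitone f↓ zero    zero    ≤v v< (suc i) = f↓ (suc i)
remaining-antitone f↓ zero    (suc m) ≤v v< zero    = remaining-≤-pred (f↓ ∘ suc) m v<
remaining-antitone f↓ zero    (suc m) ≤v v< (suc i) = remaining-antitone (f↓ ∘ suc) 0 m ≤v v< i

remaining-bottom : ∀ f a m v → remaining f a m v (a + m) ≡ v
remaining-bottom f (suc a) m       v = remaining-bottom (f ∘ suc) a m v
remaining-bottom f zero    zero    v = refl
remaining-bottom f zero    (suc m) v = remaining-bottom (f ∘ suc) 0 m v

remaining-outside : ∀ f a m v i → i < a ⊎ a + m < i → remaining f a m v i ≡ f i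
remaining-outside f (suc a) m       v zero    _                   = refl
remaining-outside f (suc a) m       v (suc i) (inj₁ i<a)          = remaining-outside (f ∘ suc) a m v i (inj₁ (s≤s⁻¹ i<a))
remaining-outside f (suc a) m       v (suc i) (inj₂ b<i)          = remaining-outside (f ∘ suc) a m v i (inj₂ (s≤s⁻¹ b<i))
remaining-outside f zero    zero    v zero    (inj₁ ())
remaining-outside f zero    zero    v zero    (inj₂ ())
remaining-outside f zero    zero    v (suc i) _                   = refl
remaining-outside f zero    (suc m) v (suc i) (inj₂ b<i)          = remaining-outside (f ∘ suc) 0 m v i (inj₂ (s≤s⁻¹ b<i))

shiftRibbon : ∀ {f g a b m} → Ribbon (f ∘ suc) (g ∘ suc) a b m → Ribbon f g (suc a) (suc b) m
shiftRibbon (end c eq)        = end c eq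
shiftRibbon (step c eq eq′ r) = step c eq eq′ (shiftRibbon r)

<⇒∃ : ∀ {m n} → m < n → ∃[ c ] n ≡ suc (c + m)
<⇒∃ {m} {n} m<n = n ∸ suc m , trans (sym (ℕ.m∸n+n≡m m<n)) (ℕ.+-suc (n ∸ suc m) m)

-- Above its bottom row the hook leaves one box less than the next row had, which is the overlap
-- condition of `step`.
remaining-ribbon : ∀ {f} → Antitone f → ∀ a m {v} → v < f (a + m) → Ribbon f (remaining f a m v) a (a + m) m
remaining-ribbon f↓ (suc a) m       v< = shiftRibbon (remaining-ribbon (f↓ ∘ suc) a m v<)
remaining-ribbon f↓ zero    zero    v< with c , eq ← <⇒∃ v< = end c eq
remaining-ribbon {f} f↓ zero (suc m) {v} v< = first (<⇒∃ (subst (_≤ f 0) f₁≡ (f↓ 0)))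
  where
  -- The hook reaches down to the nonempty row m + 1, so row 1 is nonempty and `pred` really takes
  -- away a box.
  f₁≡ : f 1 ≡ suc (pred (f 1))
  f₁≡ = sym (ℕ.suc-pred (f 1) {{>-nonZero (ℕ.<-≤-trans (ℕ.≤-<-trans z≤n v<) (antitone-≤ f↓ (s≤s z≤n)))}})
  first : ∃[ c ] f 0 ≡ suc (c + pred (f 1)) → Ribbon f (remaining f 0 (suc m) v) 0 (suc m) (suc m)
  first (c , eq) = step c eq f₁≡ (shiftRibbon (remaining-ribbon (f↓ ∘ suc) 0 m v<))

ribbon-resp : ∀ {f g g′} → (∀ i → g i ≡ g′ i) → ∀ {a b m} → Ribbon f g a b m → Ribbon f g′ a b m
ribbon-resp e (end c eq)        = end c (trans eq (cong (λ z → suc (c + z)) (e _)))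
ribbon-resp e (step c eq eq′ r) =
  step c (trans eq (cong (λ z → suc (c + z)) (e _))) (trans eq′ (cong suc (e _))) (ribbon-resp e r)

nonzeroParts : ℕ → (ℕ → ℕ) → List ℕ
nonzeroParts zero    f = []
nonzeroParts (suc N) f with f 0
... | zero  = []
... | suc x = suc x ∷ nonzeroParts N (f ∘ suc)

entry-nonzeroParts : ∀ N {f} → Antitone f → f N ≡ 0 → ∀ i → entry (nonzeroParts N f) i ≡ f i
entry-nonzeroParts zero    {f} f↓ f≡0 i = sym (ℕ.n≤0⇒n≡0 (subst (f i ≤_) f≡0 (antitone-≤ f↓ z≤n)))
entry-nonzeroParts (suc N) {f} f↓ f≡0 i with f 0 in eq
... | zero  = sym (ℕ.n≤0⇒n≡0 (subst (f i ≤_) eq (antitone-≤ f↓ z≤n)))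
entry-nonzeroParts (suc N) {f} f↓ f≡0 zero    | suc x = sym eq
entry-nonzeroParts (suc N) {f} f↓ f≡0 (suc i) | suc x = entry-nonzeroParts N (f↓ ∘ suc) f≡0 i

nonzeroParts-positive : ∀ N f → All (0 <_) (nonzeroParts N f)
nonzeroParts-positive zero    f = []
nonzeroParts-positive (suc N) f with f 0
... | zero  = []
... | suc x = z<s ∷ nonzeroParts-positive N (f ∘ suc)

∷-decreasing : ∀ {x xs} → entry xs 0 ≤ x → Linked _≥_ xs → Linked _≥_ (x ∷ xs)
∷-decreasing {xs = []}    _   _   = [-]
∷-decreasing {xs = _ ∷ _} x≥y xs↓ = x≥y ∷ xs↓

nonzeroParts-decreasing : ∀ N {f} → Antitone f → f N ≡ 0 → Linked _≥_ (nonzeroParts N f)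
nonzeroParts-decreasing zero    f↓ f≡0 = []
nonzeroParts-decreasing (suc N) {f} f↓ f≡0 with f 0 in eq
... | zero  = []
... | suc x = ∷-decreasing (subst (_≤ suc x) (sym (entry-nonzeroParts N (f↓ ∘ suc) f≡0 0)) (subst (f 1 ≤_) eq (f↓ 0)))
                           (nonzeroParts-decreasing N (f↓ ∘ suc) f≡0)

entry-length : ∀ xs → entry xs (length xs) ≡ 0
entry-length []       = refl
entry-length (_ ∷ xs) = entry-length xs

record Removal (ℓ : ℕ) (α : Partition) (a m : ℕ) : Set where
  field
    rest    : Partition
    ribbon  : Ribbon (entry (parts α)) (entry (parts rest)) a (a + m) m
    outside : ∀ i → i < a ⊎ a + m < i → entry (parts rest) i ≡ entry (parts α) i
    ℓ-size  : entry (parts α) a + m ≡ entry (parts rest) (a + m) + ℓ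

removeHook : ∀ {ℓ} α a m → Hook ℓ (entry (parts α)) a m → Removal ℓ α a m
removeHook {ℓ} α a m (f+ℓ≤ , <f+ℓ) = record
  { rest    = mkPartition (nonzeroParts N g) (nonzeroParts-decreasing N g↓ g≡0) (nonzeroParts-positive N g)
  ; ribbon  = ribbon-resp (sym ∘ e) (remaining-ribbon f↓ a m v<f)
  ; outside = λ i out → trans (e i) (remaining-outside f a m v i out)
  ; ℓ-size  = trans (sym v+ℓ) (cong (_+ ℓ) (sym (trans (e (a + m)) (remaining-bottom f a m v))))
  }
  where
  f = entry (parts α)
  f↓ = entry-antitone (decreasing α)
  -- The length ℓ forces this value for the bottom row. The first inequality of `Hook` makes the
  -- subtraction exact; the two together become f (a + m + 1) ≤ v < f (a + m).
  v = f a + m ∸ ℓ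
  g = remaining f a m v
  N = length (parts α)
  v+ℓ : v + ℓ ≡ f a + m
  v+ℓ = ℕ.m∸n+n≡m (ℕ.≤-trans (ℕ.m≤n+m ℓ _) f+ℓ≤)
  v<f : v < f (a + m)
  v<f = ℕ.+-cancelʳ-< ℓ _ _ (subst (_< f (a + m) + ℓ) (sym v+ℓ) <f+ℓ)
  f≤v : f (suc (a + m)) ≤ v
  f≤v = ℕ.+-cancelʳ-≤ ℓ _ _ (subst (f (suc (a + m)) + ℓ ≤_) (sym v+ℓ) f+ℓ≤)
  g↓ : Antitone g
  g↓ = remaining-antitone f↓ a m f≤v v<f
  g≡0 : g N ≡ 0
  g≡0 = ℕ.n≤0⇒n≡0 (subst (g N ≤_) (entry-length (parts α)) (remaining-≤ f↓ a m v<f N))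
  e : ∀ i → entry (nonzeroParts N g) i ≡ g i
  e = entry-nonzeroParts N g↓ g≡0

hook⇒nonHorizontal : ∀ {ℓ} α a m → Hook ℓ (entry (parts α)) a (suc m) → HasNonHorizontalHook ℓ α
hook⇒nonHorizontal α a m hk =
  rest , ribbonHook , ribbonHook-nonHorizontal (subst (a <_) (sym (ℕ.+-suc a m)) (s≤s (ℕ.m≤m+n a m)))
  where
  open Removal (removeHook α a (suc m) hk)
  open FromRibbon α rest ribbon outside ℓ-size

step⇒horizontal : ∀ {ℓ} α β a → 0 < ℓ → HorizontalStep ℓ (entry (parts α)) (entry (parts β)) a → RemoveHorizontal ℓ α β
step⇒horizontal {ℓ} α β a 0<ℓ (eq , same) = ribbonHook , ribbonHook-horizontal refl
  where
  f = entry (parts α)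
  g = entry (parts β)
  ribbon : Ribbon f g a a 0
  ribbon with c , eq′ ← <⇒∃ {g a} {f a} (subst (g a <_) eq (ℕ.m<m+n (g a) 0<ℓ)) = end c eq′
  outside : ∀ i → i < a ⊎ a < i → g i ≡ f i
  outside i (inj₁ i<a) = same i (ℕ.<⇒≢ i<a)
  outside i (inj₂ a<i) = same i (≢-sym (ℕ.<⇒≢ a<i))
  open FromRibbon α β ribbon outside (trans (ℕ.+-identityʳ (f a)) (sym eq))

-- Regularity from the absence of vertical hooks

count : ℕ → List ℕ → ℕ
count v xs = length (filter (ℕ._≟ v) xs)

InitialRun : List ℕ → ℕ → ℕ → Set
InitialRun xs v c = (∀ i → i < c → entry xs i ≡ v) × entry xs c < v

multiplicity : ∀ {xs} → Linked _≥_ xs → ∀ {v} → entry xs 0 ≤ v → 0 < v → InitialRun xs v (count v xs)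
multiplicity {[]} _ _ 0<v = (λ _ ()) , 0<v
multiplicity {x ∷ xs} xs↓ {v} x≤v 0<v with x ℕ.≟ v
... | yes refl = subst (InitialRun (x ∷ xs) x) (cong length (sym (filter-accept (ℕ._≟ x) refl)))
  ((λ { zero _ → refl ; (suc i) i<c → proj₁ tail i (s≤s⁻¹ i<c) }) , proj₂ tail)
  where tail = multiplicity (Linked.tail xs↓) (entry-antitone xs↓ 0) 0<v
... | no x≢v = subst (InitialRun (x ∷ xs) v)
  (trans (sym none) (cong length (sym (filter-reject (ℕ._≟ v) x≢v)))) ((λ _ ()) , x<v)
  where
  x<v = ℕ.≤∧≢⇒< x≤v x≢v
  -- An occurrence of v in xs would make v the first entry of xs, which is at most x < v.
  none : count v xs ≡ 0
  none with count v xs | proj₁ (multiplicity (Linked.tail xs↓) {v} (ℕ.≤-trans (entry-antitone xs↓ 0) x≤v) 0<v)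
  ... | zero  | _  = refl
  ... | suc c | eq = contradiction (eq 0 z<s) (ℕ.<⇒≢ (ℕ.≤-<-trans (entry-antitone xs↓ 0) x<v))

-- The last ℓ of the rows equal to v form a vertical ℓ-rim hook.
equalRows⇒hook : ∀ t {f v} c → (∀ i → i < c → f i ≡ v) → f c < v → suc t < c →
                 ∃[ a ] Hook (suc (suc t)) f a (suc t)
equalRows⇒hook t {f} {v} c ≡v <v t<c with a , refl ← <⇒∃ t<c = a
  , (begin
      f (suc (a + suc t)) + suc (suc t)  ≡⟨ ℕ.+-suc _ (suc t) ⟩
      suc (f (suc (a + suc t))) + suc t  ≤⟨ ℕ.+-monoˡ-≤ (suc t) <v ⟩
      v + suc t                          ≡⟨ cong (_+ suc t) (≡v a (s≤s (ℕ.m≤m+n a (suc t)))) ⟨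
      f a + suc t                        ∎)
  , (begin-strict
      f a + suc t                        ≡⟨ cong (_+ suc t) (≡v a (s≤s (ℕ.m≤m+n a (suc t)))) ⟩
      v + suc t                          <⟨ ℕ.+-monoʳ-< v (ℕ.n<1+n (suc t)) ⟩
      v + suc (suc t)                    ≡⟨ cong (_+ suc (suc t)) (≡v (a + suc t) (ℕ.n<1+n (a + suc t))) ⟨
      f (a + suc t) + suc (suc t)        ∎)
  where open ℕ.≤-Reasoning

manyEqual⇒hook : ∀ t {xs} → Linked _≥_ xs → All (0 <_) xs → ∀ v →
                 suc t < count v xs → ∃[ a ] Hook (suc (suc t)) (entry xs) a (suc t)
manyEqual⇒hook t {x ∷ xs} xs↓ (0<x ∷ xs>0) v many with x ℕ.≟ v
... | no x≢v with a , hk ← manyEqual⇒hook t (Linked.tail xs↓) xs>0 v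
                             (subst (suc t <_) (cong length (filter-reject (ℕ._≟ v) x≢v)) many) = suc a , hk
... | yes refl with ≡v , <v ← multiplicity xs↓ ℕ.≤-refl 0<x = equalRows⇒hook t (count x (x ∷ xs)) ≡v <v many

noNonHorizontal⇒regular : ∀ t α → ¬ HasNonHorizontalHook (suc (suc t)) α → Regular (suc (suc t)) α
noNonHorizontal⇒regular t α none v = ℕ.≰⇒> λ many →
  let a , hk = manyEqual⇒hook t (decreasing α) (Partition.positive α) v many in none (hook⇒nonHorizontal α a t hk)

-- Cores

-- Position p steps below the top row's bead in the boundary word of f is a gap.
Gap : (ℕ → ℕ) → ℕ → Set
Gap f p = ∃[ m ] Hook p f 0 m

module _ {f : ℕ → ℕ} {d} (f₀ : f 0 ≡ d + f 1) where

  private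
    lhs : ∀ p q → p + (suc d + q) ≡ suc d + (p + q)
    lhs p q = lemma p d q
      where
      lemma : ∀ p d q → p + (suc d + q) ≡ suc d + (p + q)
      lemma = ℕ-Solver.solve-∀
    rhs : ∀ m → f 0 + suc m ≡ suc d + (f 1 + m)
    rhs m = trans (cong (_+ suc m) f₀) (lemma d (f 1) m)
      where
      lemma : ∀ d y m → d + y + suc m ≡ suc d + (y + m)
      lemma = ℕ-Solver.solve-∀

  -- The bead of the second row lies d + 1 steps below that of the first, so distances measured from
  -- it are smaller by d + 1.
  gap-shift⁺ : ∀ {q m} → Hook q (f ∘ suc) 0 m → Hook (suc d + q) f 0 (suc m)
  gap-shift⁺ {q} {m} (p₁ , p₂) =
    subst₂ _≤_ (sym (lhs (f (suc (suc m))) q)) (sym (rhs m)) (ℕ.+-monoʳ-≤ (suc d) p₁) ,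
    subst₂ _<_ (sym (rhs m)) (sym (lhs (f (suc m)) q)) (ℕ.+-monoʳ-< (suc d) p₂)

  gap-shift⁻ : ∀ {q m} → Hook (suc d + q) f 0 (suc m) → Hook q (f ∘ suc) 0 m
  gap-shift⁻ {q} {m} (p₁ , p₂) =
    ℕ.+-cancelˡ-≤ (suc d) _ _ (subst₂ _≤_ (lhs (f (suc (suc m))) q) (rhs m) p₁) ,
    ℕ.+-cancelˡ-< (suc d) _ _ (subst₂ _<_ (rhs m) (lhs (f (suc m)) q) p₂)

  -- The d positions between the first two beads are gaps.
  gap-initial⁺ : ∀ {p} → 0 < p → p ≤ d → Hook p f 0 0
  gap-initial⁺ {p} 0<p p≤d =
    subst₂ _≤_ (ℕ.+-comm p (f 1)) (trans (sym f₀) (sym (ℕ.+-identityʳ (f 0)))) (ℕ.+-monoˡ-≤ (f 1) p≤d) ,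
    ℕ.+-monoʳ-< (f 0) 0<p

  gap-initial⁻ : ∀ {p} → Hook p f 0 0 → p ≤ d
  gap-initial⁻ {p} (p₁ , _) =
    ℕ.+-cancelʳ-≤ (f 1) _ _ (subst₂ _≤_ (ℕ.+-comm (f 1) p) (trans (ℕ.+-identityʳ (f 0)) f₀) p₁)

¬gap-0 : ∀ {f} → Antitone f → ¬ Gap f 0
¬gap-0 {f} f↓ (m , _ , p₂) = ℕ.<⇒≱ p₂ (begin
  f m + 0  ≡⟨ ℕ.+-identityʳ (f m) ⟩
  f m      ≤⟨ antitone-≤ f↓ z≤n ⟩
  f 0      ≤⟨ ℕ.m≤m+n (f 0) m ⟩
  f 0 + m  ∎)
  where open ℕ.≤-Reasoning

¬hook-zero : ∀ {ℓ} a m → ¬ Hook ℓ (entry []) a m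
¬hook-zero a m (p₁ , p₂) = ℕ.<⇒≱ p₂ p₁

-- Core n xs g: the (n+1)-core with parts xs has, for 1 ≤ j ≤ n, exactly g_j gaps at
-- distances congruent to j modulo n+1 below its top bead. Deleting the top row
-- re-indexes the distances from the next bead, which rotates g.
data Core (n : ℕ) : List ℕ → List ℕ → Set where
  empty : ∀ {g} → g ≡ replicate n 0 → Core n [] g
  short : ∀ {x xs g} u w → g ≡ map suc w ++ 0 ∷ u → x ≡ length w + entry xs 0 → 0 < x →
          Core n xs (u ++ 0 ∷ w) → Core n (x ∷ xs) g
  long  : ∀ {x xs g} g′ → g ≡ map suc g′ → x ≡ n + entry xs 0 → 0 < x →
          Core n xs g′ → Core n (x ∷ xs) g

+-suc-swap : ∀ x y → x + suc y ≡ y + suc x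
+-suc-swap = ℕ-Solver.solve-∀

suc-+-suc : ∀ x y → suc x + suc y ≡ suc (suc (y + x))
suc-+-suc = ℕ-Solver.solve-∀

length-rotate : ∀ (u w : List ℕ) → length (map suc w ++ 0 ∷ u) ≡ length (u ++ 0 ∷ w)
length-rotate u w = begin
  length (map suc w ++ 0 ∷ u)        ≡⟨ length-++ (map suc w) ⟩
  length (map suc w) + suc (length u) ≡⟨ cong (_+ suc (length u)) (length-map suc w) ⟩
  length w + suc (length u)          ≡⟨ +-suc-swap (length w) (length u) ⟩
  length u + suc (length w)          ≡⟨ length-++ u ⟨
  length (u ++ 0 ∷ w)                ∎
  where
  open ≡-Reasoning

core-length : ∀ {n xs g} → Core n xs g → length g ≡ n
core-length {n} (empty refl)           = length-replicate n
core-length (short u w refl _ _ core)  = trans (length-rotate u w) (core-length core)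
core-length (long g′ refl _ _ core)    = trans (length-map suc g′) (core-length core)

sum-map-suc : ∀ w → sum (map suc w) ≡ length w + sum w
sum-map-suc []      = refl
sum-map-suc (x ∷ w) = cong suc (trans (cong (x +_) (sum-map-suc w)) (lemma x (length w) (sum w)))
  where
  lemma : ∀ x y z → x + (y + z) ≡ y + (x + z)
  lemma = ℕ-Solver.solve-∀

sum-rotate : ∀ u w → sum (map suc w ++ 0 ∷ u) ≡ length w + sum (u ++ 0 ∷ w)
sum-rotate u w = begin
  sum (map suc w ++ 0 ∷ u)          ≡⟨ sum-++ (map suc w) (0 ∷ u) ⟩
  sum (map suc w) + sum u           ≡⟨ cong (_+ sum u) (sum-map-suc w) ⟩
  length w + sum w + sum u          ≡⟨ ℕ.+-assoc (length w) (sum w) (sum u) ⟩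
  length w + (sum w + sum u)        ≡⟨ cong (length w +_) (ℕ.+-comm (sum w) (sum u)) ⟩
  length w + (sum u + sum w)        ≡⟨ cong (length w +_) (sum-++ u (0 ∷ w)) ⟨
  length w + sum (u ++ 0 ∷ w)       ∎
  where open ≡-Reasoning

sum-replicate-0 : ∀ n → sum (replicate n 0) ≡ 0
sum-replicate-0 zero    = refl
sum-replicate-0 (suc n) = sum-replicate-0 n

-- The d gaps between the first two beads account for the difference of the first two parts.
core-sum : ∀ {n xs g} → Core n xs g → sum g ≡ entry xs 0
core-sum {n} (empty refl)             = sum-replicate-0 n
core-sum (short u w refl refl _ core) = trans (sum-rotate u w) (cong (length w +_) (core-sum core))
core-sum (long g′ refl refl _ core)   =
  trans (sum-map-suc g′) (cong₂ _+_ (core-length core) (core-sum core))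

core-decreasing : ∀ {n xs g} → Core n xs g → Linked _≥_ xs
core-decreasing (empty _)                          = []
core-decreasing (short {xs = xs} _ w _ refl _ core) = ∷-decreasing (ℕ.m≤n+m (entry xs 0) (length w)) (core-decreasing core)
core-decreasing {n} (long {xs = xs} _ _ refl _ core) = ∷-decreasing (ℕ.m≤n+m (entry xs 0) n) (core-decreasing core)

core-positive : ∀ {n xs g} → Core n xs g → All (0 <_) xs
core-positive (empty _)             = []
core-positive (short _ _ _ _ 0<x core) = 0<x ∷ core-positive core
core-positive (long _ _ _ 0<x core)    = 0<x ∷ core-positive core

rotate-injective : ∀ w w′ {u u′} → map suc w ++ 0 ∷ u ≡ map suc w′ ++ 0 ∷ u′ → w ≡ w′ × u ≡ u′
rotate-injective []      []        refl = refl , refl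
rotate-injective (x ∷ w) (x′ ∷ w′) eq with refl ← ∷-injectiveˡ eq
                                      with refl , refl ← rotate-injective w w′ (∷-injectiveʳ eq) = refl , refl

zero≢suc : ∀ w g {u} → map suc w ++ 0 ∷ u ≢ map suc g
zero≢suc []      []      ()
zero≢suc (_ ∷ w) []      ()
zero≢suc (_ ∷ w) (_ ∷ g) eq = zero≢suc w g (∷-injectiveʳ eq)

map-suc-injective : ∀ {g g′} → map suc g ≡ map suc g′ → g ≡ g′
map-suc-injective {[]}    {[]}    _ = refl
map-suc-injective {_ ∷ _} {_ ∷ _} eq with refl ← ∷-injectiveˡ eq = cong (_ ∷_) (map-suc-injective (∷-injectiveʳ eq))

++-injective-length : ∀ (u u′ : List ℕ) {w w′} → length u ≡ length u′ → u ++ w ≡ u′ ++ w′ → u ≡ u′ × w ≡ w′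
++-injective-length []      []        _  eq = refl , eq
++-injective-length (x ∷ u) (x′ ∷ u′) ln eq with refl ← ∷-injectiveˡ eq
  with refl , w≡w′ ← ++-injective-length u u′ (ℕ.suc-injective ln) (∷-injectiveʳ eq) = refl , w≡w′

core-short-length : ∀ {n xs} u w → Core n xs (u ++ 0 ∷ w) → length u + suc (length w) ≡ n
core-short-length u w core = trans (sym (length-++ u)) (core-length core)

-- The first difference tells `short` (less than n) from `long` (equal to n), and as the length of w
-- it fixes where the vector of the tail is cut.
core-injective : ∀ {n xs g g′} → Core n xs g → Core n xs g′ → g ≡ g′
core-injective (empty refl) (empty refl) = refl
core-injective (short {xs = xs} u w refl refl _ core) (short u′ w′ refl eq _ core′)
  with |w|≡ ← ℕ.+-cancelʳ-≡ (entry xs 0) (length w) (length w′) eq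
  with refl , refl ← ++-injective-length u u′ (ℕ.+-cancelʳ-≡ (suc (length w)) (length u) (length u′)
         (trans (core-short-length u w core) (trans (sym (core-short-length u′ w′ core′)) (cong (λ z → length u′ + suc z) (sym |w|≡)))))
         (core-injective core core′) = refl
core-injective {n} (short {xs = xs} u w refl refl _ core) (long _ _ eq _ _) =
  contradiction (ℕ.+-cancelʳ-≡ (entry xs 0) (length w) n eq)
    (ℕ.<⇒≢ (subst (length w <_) (core-short-length u w core) (ℕ.m≤n+m (suc (length w)) (length u))))
core-injective {n} (long {xs = xs} _ _ refl _ _) (short u w refl eq _ core) =
  contradiction (ℕ.+-cancelʳ-≡ (entry xs 0) (length w) n (sym eq))
    (ℕ.<⇒≢ (subst (length w <_) (core-short-length u w core) (ℕ.m≤n+m (suc (length w)) (length u))))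
core-injective (long _ refl _ _ core) (long _ refl _ _ core′) = cong (map suc) (core-injective core core′)

core-empty : ∀ {n x xs} → ¬ Core n (x ∷ xs) (replicate n 0)
core-empty {n} core = ℕ.<⇒≢ (All.head (core-positive core)) (trans (sym (sum-replicate-0 n)) (core-sum core))

-- The vector tells the constructors apart: `long` has no zero, and `short` cuts at the first one,
-- which determines w and u. The empty core is recognised by the sum.
core-functional : ∀ {n xs ys g} → Core n xs g → Core n ys g → xs ≡ ys
core-functional (empty _) (empty _) = refl
core-functional {ys = _ ∷ _} (empty refl) core = contradiction core core-empty
core-functional {xs = _ ∷ _} core (empty refl) = contradiction core core-empty
core-functional (short u w refl refl _ core) (short u′ w′ eq refl _ core′)
  with refl , refl ← rotate-injective w w′ eq = cong (λ ys → (length w + entry ys 0) ∷ ys) (core-functional core core′)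
core-functional (short u w refl _ _ _) (long g′ eq _ _ _) = contradiction eq (zero≢suc w g′)
core-functional (long g′ refl _ _ _) (short u w eq _ _ _) = contradiction (sym eq) (zero≢suc w g′)
core-functional {n} (long g′ refl refl _ core) (long g″ eq refl _ core′)
  with refl ← map-suc-injective eq = cong (λ ys → (n + entry ys 0) ∷ ys) (core-functional core core′)

firstZero : ∀ g → (∃[ g′ ] g ≡ map suc g′) ⊎ (∃[ w ] ∃[ u ] g ≡ map suc w ++ 0 ∷ u)
firstZero []         = inj₁ ([] , refl)
firstZero (zero ∷ g) = inj₂ ([] , g , refl)
firstZero (suc x ∷ g) with firstZero g
... | inj₁ (g′ , refl)     = inj₁ (x ∷ g′ , refl)
... | inj₂ (w , u , refl)  = inj₂ (x ∷ w , u , refl)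

leadingZeros : ∀ g → g ≡ replicate (length g) 0 ⊎ ∃[ z ] ∃[ y ] ∃[ u ] g ≡ replicate z 0 ++ suc y ∷ u
leadingZeros []          = inj₁ refl
leadingZeros (suc y ∷ u) = inj₂ (0 , y , u , refl)
leadingZeros (zero ∷ g) with leadingZeros g
... | inj₁ eq                  = inj₁ (cong (0 ∷_) eq)
... | inj₂ (z , y , u , refl)  = inj₂ (suc z , y , u , refl)

mutual

  -- Recursion on a bound for the sum. Passing to the tail lowers the sum by the first difference,
  -- which is positive unless g is zero throughout or begins with 0.
  core-exists : ∀ k g → sum g ≤ k → ∃[ xs ] Core (length g) xs g
  core-exists k g sum≤k with leadingZeros g
  ... | inj₁ eq                 = [] , empty eq
  ... | inj₂ (z , y , u , refl) = core-exists-nonzero k z y u sum≤k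

  -- Rotating away a leading zero keeps the sum, so the inner recursion is on the
  -- number of leading zeros.
  core-exists-nonzero : ∀ k z y u → let g = replicate z 0 ++ suc y ∷ u in
                        sum g ≤ k → ∃[ xs ] Core (length g) xs g
  core-exists-nonzero k (suc z) y u sum≤k =
    (entry xs 0 ∷ xs) , short r [] refl refl (subst (0 <_) (core-sum core) 0<sum) (subst (λ m → Core m xs (r ++ 0 ∷ [])) |r0| core)
    where
    r = replicate z 0 ++ suc y ∷ u
    assoc : replicate z 0 ++ suc y ∷ (u ++ 0 ∷ []) ≡ r ++ 0 ∷ []
    assoc = sym (++-assoc (replicate z 0) (suc y ∷ u) (0 ∷ []))
    sum≡ : sum (replicate z 0 ++ suc y ∷ (u ++ 0 ∷ [])) ≡ sum r
    sum≡ = trans (cong sum assoc) (sym (sum-rotate r []))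
    ih = core-exists-nonzero k z y (u ++ 0 ∷ []) (subst (_≤ k) (sym sum≡) sum≤k)
    xs = proj₁ ih
    core : Core (length (r ++ 0 ∷ [])) xs (r ++ 0 ∷ [])
    core = subst (λ g → Core (length g) xs g) assoc (proj₂ ih)
    |r0| : length (r ++ 0 ∷ []) ≡ suc (length r)
    |r0| = sym (length-rotate r [])
    sum-r : sum r ≡ sum (suc y ∷ u)
    sum-r = trans (sum-++ (replicate z 0) (suc y ∷ u)) (cong (_+ sum (suc y ∷ u)) (sum-replicate-0 z))
    0<sum : 0 < sum (r ++ 0 ∷ [])
    0<sum = subst (0 <_) (trans (sym sum-r) (sum-rotate r [])) z<s
  core-exists-nonzero (suc k) zero y u (s≤s sum≤k) with firstZero u
  ... | inj₁ (u′ , refl) =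
    let xs , core = core-exists k (y ∷ u′) (ℕ.≤-trans
          (ℕ.+-monoʳ-≤ y (subst (sum u′ ≤_) (sym (sum-map-suc u′)) (ℕ.m≤n+m (sum u′) (length u′)))) sum≤k)
    in _ , long (y ∷ u′) refl refl z<s (subst (λ m → Core m xs (y ∷ u′)) (cong suc (sym (length-map suc u′))) core)
  ... | inj₂ (w , u′ , refl) =
    let xs , core = core-exists k (u′ ++ 0 ∷ y ∷ w) (ℕ.≤-trans (ℕ.m≤n+m _ (length w))
          (ℕ.≤-trans (ℕ.≤-reflexive (sym (ℕ.suc-injective (sum-rotate u′ (y ∷ w))))) sum≤k))
    in _ , short u′ (y ∷ w) refl refl z<s (subst (λ m → Core m xs (u′ ++ 0 ∷ y ∷ w)) (sym (length-rotate u′ (y ∷ w))) core)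

entry-++ʳ : ∀ u {w} k → entry (u ++ w) (length u + k) ≡ entry w k
entry-++ʳ []      k = refl
entry-++ʳ (x ∷ u) k = entry-++ʳ u k

entry-++ˡ : ∀ u {w i} → i < length u → entry (u ++ w) i ≡ entry u i
entry-++ˡ (x ∷ u) {i = zero}  _         = refl
entry-++ˡ (x ∷ u) {i = suc i} (s≤s i<u) = entry-++ˡ u i<u

entry-map-suc : ∀ w {i} → i < length w → 0 < entry (map suc w) i
entry-map-suc (x ∷ w) {zero}  _         = z<s
entry-map-suc (x ∷ w) {suc i} (s≤s i<w) = entry-map-suc w i<w

entry-replicate-0 : ∀ n i → entry (replicate n 0) i ≡ 0
entry-replicate-0 zero    i       = refl
entry-replicate-0 (suc n) zero    = refl
entry-replicate-0 (suc n) (suc i) = entry-replicate-0 n i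

entry-rotateˡ : ∀ w {u i} → i < length w → 0 < entry (map suc w ++ 0 ∷ u) i
entry-rotateˡ w i<w = subst (0 <_) (sym (entry-++ˡ (map suc w) (subst (_ <_) (sym (length-map suc w)) i<w))) (entry-map-suc w i<w)

entry-rotateʳ : ∀ w {u} k → entry (map suc w ++ 0 ∷ u) (length w + k) ≡ entry (0 ∷ u) k
entry-rotateʳ w {u} k = trans (cong (λ z → entry (map suc w ++ 0 ∷ u) (z + k)) (sym (length-map suc w))) (entry-++ʳ (map suc w) k)

core-antitone : ∀ {n xs g} → Core n xs g → Antitone (entry xs)
core-antitone core = entry-antitone (core-decreasing core)

data Position (d : ℕ) : ℕ → Set where
  before : ∀ {i} → i < d → Position d i
  after  : ∀ k → Position d (d + k)

position : ∀ d i → Position d i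
position d i with i ℕ.<? d
... | yes i<d = before i<d
... | no i≮d  = subst (Position d) (ℕ.m+[n∸m]≡n (ℕ.≮⇒≥ i≮d)) (after (i ∸ d))

-- In a core the gaps of a class are those of its positions nearest to the top bead, so a class has
-- a gap when its least distance i + 1 is one. Distances up to d lie between the first two beads, d
-- + 1 is the second bead, and larger ones pass to the tail.
core-gap⁺ : ∀ {n xs g} → Core n xs g → ∀ i → i < n → 0 < entry g i → Gap (entry xs) (suc i)
core-gap⁺ {n} (empty refl) i _ 0<g = contradiction (sym (entry-replicate-0 n i)) (ℕ.<⇒≢ 0<g)
core-gap⁺ (short {xs = xs} u w refl refl _ core) i i<n 0<g with position (length w) i
... | before i<d  = 0 , gap-initial⁺ {entry (_ ∷ xs)} refl z<s i<d
... | after k with k | subst (0 <_) (entry-rotateʳ w k) 0<g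
...   | suc k | 0<u =
  let k<u : k < length u
      k<u = ℕ.+-cancelʳ-< (suc (length w)) _ _ (subst₂ _<_ (+-suc-swap (length w) k) (sym (core-short-length u w core)) i<n)
      m , hk = core-gap⁺ core k (ℕ.<-≤-trans k<u (subst (length u ≤_) (core-short-length u w core) (ℕ.m≤m+n _ _)))
                 (subst (0 <_) (sym (entry-++ˡ u k<u)) 0<u)
  in suc m , gap-shift⁺ {entry ((length w + entry xs 0) ∷ xs)} refl hk
core-gap⁺ (long {xs = xs} g′ refl refl _ core) i i<n _ = 0 , gap-initial⁺ {entry (_ ∷ xs)} refl z<s i<n

core-gap⁻ : ∀ {n xs g} → Core n xs g → ∀ i → i < n → Gap (entry xs) (suc i) → 0 < entry g i
core-gap⁻ (empty _) i _ (m , hk) = contradiction hk (¬hook-zero 0 m)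
core-gap⁻ (short {xs = xs} u w refl refl _ core) i i<n gap with position (length w) i
... | before i<d = entry-rotateˡ w i<d
... | after k with gap
...   | zero , hk = contradiction (gap-initial⁻ {entry (_ ∷ xs)} refl hk) (ℕ.<⇒≱ (s≤s (ℕ.m≤m+n (length w) k)))
...   | suc m , hk with k | gap-shift⁻ {entry (_ ∷ xs)} refl {k} hk
...     | zero  | hk′ = contradiction (m , hk′) (¬gap-0 (core-antitone core))
...     | suc k | hk′ =
  let k<u : k < length u
      k<u = ℕ.+-cancelʳ-< (suc (length w)) _ _ (subst₂ _<_ (+-suc-swap (length w) k) (sym (core-short-length u w core)) i<n)
  in subst (0 <_) (trans (entry-++ˡ u k<u) (sym (entry-rotateʳ w (suc k))))
       (core-gap⁻ core k (ℕ.<-≤-trans k<u (subst (length u ≤_) (core-short-length u w core) (ℕ.m≤m+n _ _))) (m , hk′))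
core-gap⁻ (long g′ refl _ _ core) i i<n _ = entry-map-suc g′ (subst (i <_) (sym (core-length core)) i<n)

-- A hook with top row 0 is a gap at distance n + 1. For `short` this is distance `length u` + 1
-- below the second bead, where the rotated vector has the 0 of the old top bead's class; for `long`
-- it is the second bead itself.
core-noHook : ∀ {n xs g} → Core n xs g → ∀ a m → ¬ Hook (suc n) (entry xs) a m
core-noHook (empty _)              a       m hk = ¬hook-zero a m hk
core-noHook (short _ _ _ _ _ core) (suc a) m hk = core-noHook core a m hk
core-noHook (long _ _ _ _ core)    (suc a) m hk = core-noHook core a m hk
core-noHook {n} (short {xs = xs} u w _ refl _ core) zero zero hk =
  ℕ.<⇒≱ (subst (length w <_) (core-short-length u w core) (ℕ.m≤n+m (suc (length w)) (length u)))
        (ℕ.≤-trans (ℕ.n≤1+n n) (gap-initial⁻ {entry (_ ∷ xs)} refl hk))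
core-noHook {n} (short {xs = xs} u w _ refl _ core) zero (suc m) hk =
  ℕ.<⇒≢ (core-gap⁻ core (length u) u<n (m , gap-shift⁻ {entry (_ ∷ xs)} refl
          (subst (λ p → Hook p (entry ((length w + entry xs 0) ∷ xs)) 0 (suc m)) 1+n≡ hk)))
        (sym (trans (cong (entry (u ++ 0 ∷ w)) (sym (ℕ.+-identityʳ (length u)))) (entry-++ʳ u 0)))
  where
  u<n : length u < n
  u<n = subst (length u <_) (core-short-length u w core) (ℕ.m<m+n (length u) z<s)
  1+n≡ : suc n ≡ suc (length w) + suc (length u)
  1+n≡ = trans (cong suc (sym (core-short-length u w core)))
    (trans (cong suc (ℕ.+-suc (length u) (length w))) (sym (suc-+-suc (length w) (length u))))
core-noHook {n} (long {xs = xs} _ _ refl _ _) zero zero hk = ℕ.1+n≰n (gap-initial⁻ {entry (_ ∷ xs)} refl hk)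
core-noHook {n} (long {xs = xs} _ _ refl _ core) zero (suc m) hk = ¬gap-0 (core-antitone core)
  (m , gap-shift⁻ {entry (_ ∷ xs)} refl
    (subst (λ p → Hook p (entry ((n + entry xs 0) ∷ xs)) 0 (suc m)) (sym (ℕ.+-identityʳ (suc n))) hk))

split : ∀ g e → e < length g → entry g e ≡ 0 → ∃[ u ] ∃[ w ] g ≡ u ++ 0 ∷ w × length u ≡ e
split (x ∷ g) zero    _         refl = [] , g , refl , refl
split (x ∷ g) (suc e) (s≤s e<g) eq with u , w , refl , refl ← split g e e<g eq = x ∷ u , w , refl , refl

-- A first difference d > n would give a horizontal hook, and d = n is the case `long`. For d < n
-- the vector of the tail has to be cut at a zero, which the absence of hooks provides.
noHook⇒core : ∀ n {xs} → Linked _≥_ xs → All (0 <_) xs → (∀ a m → ¬ Hook (suc n) (entry xs) a m) → ∃[ g ] Core n xs g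
noHook⇒core n {[]} _ _ _ = replicate n 0 , empty refl
noHook⇒core n {x ∷ xs} xs↓ (0<x ∷ xs>0) none
  with g , core ← noHook⇒core n (Linked.tail xs↓) xs>0 (λ a m → none (suc a) m)
  with ℕ.<-cmp (x ∸ entry xs 0) n
... | tri> _ _ n<d = contradiction (gap-initial⁺ {entry (x ∷ xs)} (sym (ℕ.m∸n+n≡m (entry-antitone xs↓ 0))) z<s n<d) (none 0 0)
... | tri≈ _ d≡n _ = map suc g , long g refl (trans (sym (ℕ.m∸n+n≡m (entry-antitone xs↓ 0))) (cong (_+ entry xs 0) d≡n)) 0<x core
-- Here n = e + d + 1, so distance e + 1 below the second bead is distance n + 1 below the top one.
-- A gap there would be a hook.
... | tri< d<n _ _ with e , refl ← <⇒∃ d<n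
  with u , w , refl , refl ← split g e (subst (e <_) (sym (core-length core)) (s≤s (ℕ.m≤m+n e _)))
         (ℕ.n≤0⇒n≡0 (ℕ.≮⇒≥ λ 0<g →
           let m , hk = core-gap⁺ core e (s≤s (ℕ.m≤m+n e _)) 0<g
           in none 0 (suc m) (subst (λ p → Hook p (entry (x ∷ xs)) 0 (suc m)) (suc-+-suc (x ∸ entry xs 0) e)
                (gap-shift⁺ {entry (x ∷ xs)} (sym (ℕ.m∸n+n≡m (entry-antitone xs↓ 0))) hk))))
  = map suc w ++ 0 ∷ u , short u w refl (trans (sym (ℕ.m∸n+n≡m (entry-antitone xs↓ 0))) (cong (_+ entry xs 0) d≡)) 0<x core
  where
  d≡ : x ∸ entry xs 0 ≡ length w
  d≡ = ℕ.+-cancelˡ-≡ (length u) _ _ (ℕ.suc-injective (trans (sym (core-short-length u w core)) (ℕ.+-suc (length u) (length w))))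

-- ℓ-partitions

step-≤ : ∀ {ℓ f g a} → HorizontalStep ℓ f g a → ∀ i → g i ≤ f i
step-≤ {ℓ} {f} {g} {a} (eq , same) i with i ℕ.≟ a
... | yes refl = subst (g a ≤_) eq (ℕ.m≤m+n (g a) ℓ)
... | no i≢a   = ℕ.≤-reflexive (same i i≢a)

step⇒hook : ∀ {ℓ f g a} → 0 < ℓ → Antitone g → HorizontalStep ℓ f g a → Hook ℓ f a 0
step⇒hook {ℓ} {f} {g} {a} 0<ℓ g↓ (eq , same) =
  (begin
    f (suc (a + 0)) + ℓ  ≡⟨ cong (λ z → f (suc z) + ℓ) (ℕ.+-identityʳ a) ⟩
    f (suc a) + ℓ        ≡⟨ cong (_+ ℓ) (same (suc a) ℕ.1+n≢n) ⟨
    g (suc a) + ℓ        ≤⟨ ℕ.+-monoˡ-≤ ℓ (g↓ a) ⟩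
    g a + ℓ              ≡⟨ eq ⟩
    f a                  ≡⟨ ℕ.+-identityʳ (f a) ⟨
    f a + 0              ∎) ,
  subst (λ z → f a + 0 < f z + ℓ) (sym (ℕ.+-identityʳ a)) (ℕ.+-monoʳ-< (f a) 0<ℓ)
  where open ℕ.≤-Reasoning

-- The closure of the ℓ-cores under the inverses of the two bijections; ℓ = n + 1.
data Generated (n : ℕ) : (ℕ → ℕ) → Set where
  hookless : ∀ {f} → Antitone f → (∀ a m → ¬ Hook (suc n) f a m) → Generated n f
  adjoin : ∀ {f} → f 0 ≡ n + f 1 → Generated n (f ∘ suc) → Generated n f
  widen : ∀ {f g} → HorizontalStep (suc n) f g 0 → Generated n g → Generated n f

generated-antitone : ∀ {n f} → Generated n f → Antitone f
generated-antitone (hookless f↓ _) = f↓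
generated-antitone {n} {f} (adjoin eq gen) zero = subst (f 1 ≤_) (sym eq) (ℕ.m≤n+m (f 1) n)
generated-antitone (adjoin eq gen) (suc i) = generated-antitone gen i
generated-antitone {n} {f} (widen {g = g} (eq , same) gen) zero = begin
  f 1          ≡⟨ same 1 (λ ()) ⟨
  g 1          ≤⟨ generated-antitone gen 0 ⟩
  g 0          ≤⟨ ℕ.m≤m+n (g 0) (suc n) ⟩
  g 0 + suc n  ≡⟨ eq ⟩
  f 0          ∎
  where open ℕ.≤-Reasoning
generated-antitone {n} {f} (widen (eq , same) gen) (suc i) =
  subst₂ _≤_ (same (suc (suc i)) (λ ())) (same (suc i) (λ ())) (generated-antitone gen (suc i))

generated-resp : ∀ {n f g} → (∀ i → f i ≡ g i) → Generated n f → Generated n g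
generated-resp {n} {f} {g} e (hookless f↓ none) = hookless (λ i → subst₂ _≤_ (e (suc i)) (e i) (f↓ i)) λ a m (p₁ , p₂) →
  none a m ( subst₂ (λ x y → x + suc n ≤ y + m) (sym (e (suc (a + m)))) (sym (e a)) p₁
           , subst₂ (λ x y → x + m < y + suc n) (sym (e a)) (sym (e (a + m))) p₂ )
generated-resp {n} e (adjoin eq gen) =
  adjoin (trans (sym (e 0)) (trans eq (cong (n +_) (e 1)))) (generated-resp (e ∘ suc) gen)
generated-resp e (widen (eq , same) gen) =
  widen (trans eq (e 0) , λ i i≢0 → trans (same i i≢0) (e i)) gen

-- Both operations leave f 0 ≥ f 1 + n, and then the second inequality of `Hook` fails for every
-- hook that leads from row 0 to a lower row.
generated-noHook : ∀ {n f} → Generated n f → ∀ a m → ¬ Hook (suc n) f a (suc m)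
generated-noHook (hookless _ none) a       m = none a (suc m)
generated-noHook (adjoin _ gen)   (suc a) m = generated-noHook gen a m
generated-noHook {n} {f} gen@(adjoin eq _) zero m (_ , p₂) = ℕ.<⇒≱ p₂ (begin
  f (suc m) + suc n    ≤⟨ ℕ.+-monoˡ-≤ (suc n) (antitone-≤ (generated-antitone gen) (s≤s z≤n)) ⟩
  f 1 + suc n          ≡⟨ ℕ.+-suc (f 1) n ⟩
  suc (f 1 + n)        ≡⟨ cong suc (trans (ℕ.+-comm (f 1) n) (sym eq)) ⟩
  suc (f 0)            ≤⟨ s≤s (ℕ.m≤m+n (f 0) m) ⟩
  suc (f 0 + m)        ≡⟨ ℕ.+-suc (f 0) m ⟨
  f 0 + suc m          ∎)
  where open ℕ.≤-Reasoning
generated-noHook {n} {f} (widen (_ , same) gen) (suc a) m (p₁ , p₂) = generated-noHook gen (suc a) m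
  ( subst₂ (λ x y → x + suc n ≤ y + suc m) (sym (same _ λ ())) (sym (same _ λ ())) p₁
  , subst₂ (λ x y → x + suc m < y + suc n) (sym (same _ λ ())) (sym (same _ λ ())) p₂ )
generated-noHook {n} {f} (widen {g = g} (eq , same) gen) zero m (_ , p₂) = ℕ.<⇒≱ p₂ (begin
  f (suc m) + suc n    ≡⟨ cong (_+ suc n) (same (suc m) (λ ())) ⟨
  g (suc m) + suc n    ≤⟨ ℕ.+-monoˡ-≤ (suc n) (antitone-≤ (generated-antitone gen) z≤n) ⟩
  g 0 + suc n          ≡⟨ eq ⟩
  f 0                  ≤⟨ ℕ.m≤m+n (f 0) (suc m) ⟩
  f 0 + suc m          ∎)
  where open ℕ.≤-Reasoning

infixr 5 _◂_
_◂_ : ℕ → (ℕ → ℕ) → (ℕ → ℕ)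
(x ◂ f) zero    = x
(x ◂ f) (suc i) = f i

-- A removal in row 0 undoes a widening and is impossible for an adjoined row; one further down
-- commutes with either operation, except in row 1 below an adjoined row, whose difference n it
-- destroys.
generated-step : ∀ {n f g} a → Generated n f → Antitone g → HorizontalStep (suc n) f g a → Generated n g
generated-step a (hookless _ none) g↓ st = contradiction (step⇒hook z<s g↓ st) (none a 0)
generated-step {n} {f} {g} zero (adjoin eq _) g↓ (eq′ , same) = contradiction (begin
  suc n + g 0  ≡⟨ ℕ.+-comm (suc n) (g 0) ⟩
  g 0 + suc n  ≡⟨ eq′ ⟩
  f 0          ≡⟨ eq ⟩
  n + f 1      ≡⟨ cong (n +_) (same 1 λ ()) ⟨
  n + g 1      ≤⟨ ℕ.+-monoʳ-≤ n (g↓ 0) ⟩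
  n + g 0      ∎) ℕ.1+n≰n
  where open ℕ.≤-Reasoning
generated-step {n} {f} {g} 1 (adjoin eq gen) g↓ (eq′ , same) =
  -- The first difference has grown to n + (n + 1): the top row is the one adjoined to the new tail,
  -- n + g 1, widened by n + 1.
  widen {g = (n + g 1) ◂ g ∘ suc} (widened , λ { zero 0≢0 → contradiction refl 0≢0 ; (suc i) _ → refl })
    (adjoin refl (generated-step 0 gen (g↓ ∘ suc) (eq′ , λ i i≢a → same (suc i) (i≢a ∘ ℕ.suc-injective))))
  where
  widened : n + g 1 + suc n ≡ g 0
  widened = trans (ℕ.+-assoc n (g 1) (suc n)) (trans (cong (n +_) eq′) (trans (sym eq) (sym (same 0 λ ()))))
generated-step {n} (suc (suc a)) (adjoin eq gen) g↓ (eq′ , same) =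
  adjoin (trans (same 0 λ ()) (trans eq (cong (n +_) (sym (same 1 λ ())))))
    (generated-step (suc a) gen (g↓ ∘ suc) (eq′ , λ i i≢a → same (suc i) (i≢a ∘ ℕ.suc-injective)))
generated-step {n} {f} {g} zero (widen (eq , same) gen) g↓ (eq′ , same′) = generated-resp agree gen
  where
  agree : ∀ i → _ ≡ g i
  agree zero    = ℕ.+-cancelʳ-≡ (suc n) _ _ (trans eq (sym eq′))
  agree (suc i) = trans (same (suc i) λ ()) (sym (same′ (suc i) λ ()))
generated-step {n} {f} {g} (suc a) (widen {g = h} (eq , same) gen) g↓ (eq′ , same′) =
  widen {g = h′} (trans eq (sym (same′ 0 λ ())) , λ { zero 0≢0 → contradiction refl 0≢0 ; (suc i) _ → refl })
    (generated-step (suc a) gen h′↓ (trans eq′ (sym (same (suc a) λ ())) , λ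
      { zero    _  → refl
      ; (suc i) ≢a → trans (same′ (suc i) ≢a) (sym (same (suc i) λ ())) }))
  where
  h′ = h 0 ◂ g ∘ suc
  h′↓ : Antitone h′
  -- The narrower first row still suffices: h 0 ≥ h 1 = f 1 ≥ g 1.
  h′↓ zero    = ℕ.≤-trans (step-≤ (eq′ , same′) 1) (subst (_≤ h 0) (same 1 λ ()) (generated-antitone gen 0))
  h′↓ (suc i) = g↓ (suc i)

Stable : ℕ → Partition → Set
Stable ℓ α = ∀ β → Star (RemoveHorizontal ℓ) α β → ¬ HasNonHorizontalHook ℓ β

generated⇒stable : ∀ {n} α → Generated n (entry (parts α)) → Stable (suc n) α
generated⇒stable α gen .α ε (β , h , ¬hor) =
  let a , m , hk = FromRimHook.nonHorizontal⇒hook h z<s ¬hor in generated-noHook gen a m hk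
generated⇒stable α gen γ (_◅_ {j = β} (h , hor) steps) =
  let a , st = FromRimHook.horizontal⇒step h z<s hor
  in generated⇒stable β (generated-step a gen (entry-antitone (decreasing β)) st) γ steps

parts-injective : ∀ {α β} → parts α ≡ parts β → α ≡ β
parts-injective {mkPartition xs ↓ pos} {mkPartition .xs ↓′ pos′} refl =
  cong₂ (mkPartition xs) (Linked.irrelevant ℕ.≤-irrelevant ↓ ↓′) (All.irrelevant ℕ.<-irrelevant pos pos′)

entry-injective : ∀ {xs ys} → All (0 <_) xs → All (0 <_) ys → (∀ i → entry xs i ≡ entry ys i) → xs ≡ ys
entry-injective []        []        e = refl
entry-injective []        (0<y ∷ _) e = contradiction (e 0) (ℕ.<⇒≢ 0<y)
entry-injective (0<x ∷ _) []        e = contradiction (sym (e 0)) (ℕ.<⇒≢ 0<x)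
entry-injective (_ ∷ xs>0) (_ ∷ ys>0) e = cong₂ _∷_ (e 0) (entry-injective xs>0 ys>0 (e ∘ suc))

≗⇒≡ : ∀ {α β} → (∀ i → entry (parts α) i ≡ entry (parts β) i) → α ≡ β
≗⇒≡ {α} {β} e = parts-injective (entry-injective (Partition.positive α) (Partition.positive β) e)

cons : ∀ x α → firstPart α ≤ x → 0 < x → Partition
cons x α α≤x 0<x = mkPartition (x ∷ parts α) (∷-decreasing α≤x (decreasing α)) (0<x ∷ Partition.positive α)

-- Hooks and removals of α recur one row lower under a new top row x. Removals only shrink the first
-- part of α, so x remains large enough throughout.
stable-tail : ∀ {ℓ x} α α≤x 0<x → 0 < ℓ → Stable ℓ (cons x α α≤x 0<x) → Stable ℓ α
stable-tail {x = x} α α≤x 0<x 0<ℓ stable .α ε (β , h , ¬hor) =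
  let a , m , hk = FromRimHook.nonHorizontal⇒hook h 0<ℓ ¬hor
  in stable _ ε (hook⇒nonHorizontal (cons x α α≤x 0<x) (suc a) m hk)
stable-tail {x = x} α α≤x 0<x 0<ℓ stable γ (_◅_ {j = β} (h , hor) steps) =
  stable-tail β β≤x 0<x 0<ℓ (λ δ steps′ →
    stable δ (step⇒horizontal (cons x α α≤x 0<x) (cons x β β≤x 0<x) (suc a) 0<ℓ lifted ◅ steps′)) γ steps
  where
  a = proj₁ (FromRimHook.horizontal⇒step h 0<ℓ hor)
  st = proj₂ (FromRimHook.horizontal⇒step h 0<ℓ hor)
  β≤x = ℕ.≤-trans (FromRimHook.g≤f h 0) α≤x
  lifted = proj₁ st , λ { zero _ → refl ; (suc i) ≢a → proj₂ st i (≢a ∘ cong suc) }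

-- Enumeration of the ℓ-partitions by first part

module _ (t : ℕ) where

  private
    n = suc t
    ℓ = suc n

  corePartition : List ℕ → Partition
  corePartition g = let xs , c = core-exists (sum g) g ℕ.≤-refl in mkPartition xs (core-decreasing c) (core-positive c)

  corePartition-core : ∀ g → Core (length g) (parts (corePartition g)) g
  corePartition-core g = proj₂ (core-exists (sum g) g ℕ.≤-refl)

  addRow : Partition → Partition
  addRow α = cons (n + firstPart α) α (ℕ.m≤n+m (firstPart α) n) z<s

  widenFirst : Partition → Partition
  widenFirst (mkPartition [] _ _)                   = mkPartition (ℓ ∷ []) [-] (z<s ∷ [])
  widenFirst (mkPartition (x ∷ xs) xs↓ (_ ∷ xs>0)) = mkPartition ((x + ℓ) ∷ xs)
    (∷-decreasing (ℕ.≤-trans (entry-antitone xs↓ 0) (ℕ.m≤m+n x ℓ)) (Linked.tail xs↓))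
    (subst (0 <_) (sym (ℕ.+-suc x n)) z<s ∷ xs>0)

  widenFirst-step : ∀ α → HorizontalStep ℓ (entry (parts (widenFirst α))) (entry (parts α)) 0
  widenFirst-step (mkPartition [] _ _)            = refl , λ { zero 0≢0 → contradiction refl 0≢0 ; (suc i) _ → refl }
  widenFirst-step (mkPartition (x ∷ xs) _ (_ ∷ _)) = refl , λ { zero 0≢0 → contradiction refl 0≢0 ; (suc i) _ → refl }

  addRow-injective : ∀ {α β} → addRow α ≡ addRow β → α ≡ β
  addRow-injective eq = parts-injective (∷-injectiveʳ (cong parts eq))

  widenFirst-injective : ∀ {α β} → widenFirst α ≡ widenFirst β → α ≡ β
  widenFirst-injective {α} {β} eq = ≗⇒≡ λ
    { zero    → ℕ.+-cancelʳ-≡ ℓ _ _ (trans (proj₁ (widenFirst-step α))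
                  (trans (cong firstPart eq) (sym (proj₁ (widenFirst-step β)))))
    ; (suc i) → trans (proj₂ (widenFirst-step α) (suc i) λ ())
                  (trans (cong (λ γ → entry (parts γ) (suc i)) eq) (sym (proj₂ (widenFirst-step β) (suc i) λ ()))) }

  -- `short` has a zero and a difference `length w` < n, `long` has neither. The empty core belongs
  -- with `short` because n ≥ 1.
  core-short : ∀ {xs g} → Core n xs g → 0 ∈ g → entry xs 0 < entry xs 1 + n
  core-short (empty _) _ = z<s
  core-short (short {xs = xs} u w _ refl _ c) _ = subst (_< entry xs 0 + n) (ℕ.+-comm (entry xs 0) (length w))
    (ℕ.+-monoʳ-< (entry xs 0) (subst (length w <_) (core-short-length u w c) (ℕ.m≤n+m (suc (length w)) (length u))))
  core-short (long g′ refl _ _ _) 0∈g with _ , _ , () ← ∈-map⁻ suc 0∈g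

  core-short⁻ : ∀ {xs g} → Core n xs g → entry xs 0 < entry xs 1 + n → 0 ∈ g
  core-short⁻ (empty refl) _ = here refl
  core-short⁻ (short u w refl _ _ _) _ = ∈-++⁺ʳ (map suc w) (here refl)
  core-short⁻ (long {xs = xs} _ _ refl _ _) lt = contradiction (ℕ.+-comm n (entry xs 0)) (ℕ.<⇒≢ lt)

  shortCores : ℕ → List Partition
  shortCores k = map corePartition (zeroVectors n k)

  open Recurrence shortCores addRow widenFirst t

  ∈-shortCores⁻ : ∀ k {α} → α ∈ shortCores k → ∃[ g ] Core n (parts α) g × 0 ∈ g × firstPart α ≡ k
  ∈-shortCores⁻ k α∈ with g , g∈ , refl ← ∈-map⁻ corePartition α∈
                     with |g| , refl , 0∈g ← ∈-zeroVectors⁻ n k g∈ =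
    g , subst (λ m → Core m (parts (corePartition g)) g) |g| (corePartition-core g) , 0∈g , sym (core-sum (corePartition-core g))

  -- Only one core has the vector g, so α is the one chosen by `corePartition`.
  ∈-shortCores⁺ : ∀ α {g} → Core n (parts α) g → 0 ∈ g → α ∈ shortCores (firstPart α)
  ∈-shortCores⁺ α {g} c 0∈g = subst₂ (λ β k → β ∈ shortCores k)
    (parts-injective (core-functional (subst (λ m → Core m (parts (corePartition g)) g) (core-length c) (corePartition-core g)) c))
    (core-sum c)
    (∈-map⁺ corePartition (subst (λ m → g ∈ zeroVectors m (sum g)) (core-length c) (∈-zeroVectors⁺ g 0∈g)))

  ∈-approximation⁻ : ∀ s k {α} → α ∈ approximation s k → Generated n (entry (parts α)) × firstPart α ≡ k
  ∈-approximation⁻ (suc s) k α∈ with ∈-++⁻ (shortCores k) α∈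
  ... | inj₁ α∈ˡ with g , c , _ , eq ← ∈-shortCores⁻ k α∈ˡ = hookless (core-antitone c) (core-noHook c) , eq
  ... | inj₂ α∈ʳ with ∈-++⁻ (map addRow (delay n (approximation s) k)) α∈ʳ
  ...   | inj₁ α∈ᵐ with β , β∈ , refl ← ∈-map⁻ addRow α∈ᵐ
                   with j , β∈′ , refl ← ∈-delay⁻ n k β∈
                   with gen , refl ← ∈-approximation⁻ s j β∈′ = adjoin refl gen , refl
  ...   | inj₂ α∈ᵐ with β , β∈ , refl ← ∈-map⁻ widenFirst α∈ᵐ
                   with j , β∈′ , refl ← ∈-delay⁻ ℓ k β∈
                   with gen , refl ← ∈-approximation⁻ s j β∈′ =
    widen (widenFirst-step β) gen , trans (sym (proj₁ (widenFirst-step β))) (ℕ.+-comm (firstPart β) ℓ)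

  -- Consecutive differences below n propagate downwards: a first difference ≥ n
  -- below one < n would give a two-row hook.
  short-rows : ∀ {f} → Antitone f → (∀ a m → ¬ Hook ℓ f a (suc m)) → f 0 < f 1 + n → ∀ i → f i < f (suc i) + n
  short-rows f↓ none f₀< zero    = f₀<
  short-rows {f} f↓ none f₀< (suc i) = ℕ.≰⇒> λ f≥ → none i 0
    (subst (λ z → f (suc z) + ℓ ≤ f i + 1 × f i + 1 < f z + ℓ) (ℕ.+-comm 1 i)
    ( (begin
        f (suc (suc i)) + suc n    ≡⟨ ℕ.+-suc _ n ⟩
        suc (f (suc (suc i)) + n)  ≤⟨ s≤s (ℕ.≤-trans f≥ (f↓ i)) ⟩
        suc (f i)                  ≡⟨ ℕ.+-comm 1 (f i) ⟩
        f i + 1                    ∎)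
    , (begin-strict
        f i + 1                    ≡⟨ ℕ.+-comm (f i) 1 ⟩
        suc (f i)                  <⟨ s≤s (short-rows f↓ none f₀< i) ⟩
        suc (f (suc i) + n)        ≡⟨ ℕ.+-suc _ n ⟨
        f (suc i) + suc n          ∎)))
    where open ℕ.≤-Reasoning

  -- A horizontal hook in row a needs a difference of at least n + 1 there.
  short-noHook : ∀ {f} → Antitone f → (∀ a m → ¬ Hook ℓ f a (suc m)) → f 0 < f 1 + n → ∀ a m → ¬ Hook ℓ f a m
  short-noHook f↓ none f₀< a (suc m) = none a m
  short-noHook {f} f↓ none f₀< a zero (p₁ , _) = ℕ.<⇒≱ (short-rows f↓ none f₀< a) (begin
    f (suc a) + n           ≤⟨ ℕ.+-monoʳ-≤ (f (suc a)) (ℕ.n≤1+n n) ⟩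
    f (suc a) + suc n       ≡⟨ cong (λ z → f (suc z) + suc n) (ℕ.+-identityʳ a) ⟨
    f (suc (a + 0)) + suc n ≤⟨ p₁ ⟩
    f a + 0                 ≡⟨ ℕ.+-identityʳ (f a) ⟩
    f a                     ∎)
    where open ℕ.≤-Reasoning

  stable-noHook : ∀ α → Stable ℓ α → ∀ a m → ¬ Hook ℓ (entry (parts α)) a (suc m)
  stable-noHook α stable a m hk = stable α ε (hook⇒nonHorizontal α a m hk)

  ∈-addRow : ∀ s k α → α ∈ approximation s k → addRow α ∈ approximation (suc s) (n + k)
  ∈-addRow s k α α∈ = ∈-++⁺ʳ (shortCores (n + k)) (∈-++⁺ˡ (∈-map⁺ addRow (∈-delay⁺ n {approximation s} α∈)))

  ∈-widenFirst : ∀ s k α → α ∈ approximation s k → widenFirst α ∈ approximation (suc s) (ℓ + k)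
  ∈-widenFirst s k α α∈ = ∈-++⁺ʳ (shortCores (ℓ + k)) (∈-++⁺ʳ (map addRow (delay n (approximation s) (ℓ + k)))
    (∈-map⁺ widenFirst (∈-delay⁺ ℓ {approximation s} α∈)))

  -- Induction on the first part, split by comparing the first difference with n. Deleting the top
  -- row lowers the first part by n and narrowing it lowers it by n + 1. Stability passes to the
  -- tail by `stable-tail`, and to the narrowed partition because the narrowing is itself a removal.
  ∈-approximation⁺ : ∀ s α → Stable ℓ α → firstPart α < s → α ∈ approximation s (firstPart α)
  ∈-approximation⁺ (suc s) α stable (s≤s α≤s) with ℕ.<-cmp (firstPart α) (entry (parts α) 1 + n)
  ... | tri< α₀< _ _ =
    let g , c = noHook⇒core n (decreasing α) (Partition.positive α)
                  (short-noHook (entry-antitone (decreasing α)) (stable-noHook α stable) α₀<)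
    in ∈-++⁺ˡ (∈-shortCores⁺ α c (core-short⁻ c α₀<))
  ∈-approximation⁺ (suc s) (mkPartition (x ∷ xs) xs↓ (0<x ∷ xs>0)) stable (s≤s α≤s) | tri≈ _ refl _ =
    subst₂ (λ β k → β ∈ approximation (suc s) k) (parts-injective (cong (_∷ xs) (ℕ.+-comm n (entry xs 0))))
      (ℕ.+-comm n (entry xs 0))
      (∈-addRow s (firstPart τ) τ (∈-approximation⁺ s τ
        -- `cons` rebuilds the order and positivity proofs, so its result equals the given partition
        -- only up to their irrelevance.
        (stable-tail τ (entry-antitone xs↓ 0) 0<x z<s (subst (Stable ℓ) (parts-injective refl) stable))
        (ℕ.<-≤-trans (ℕ.m<m+n (firstPart τ) z<s) α≤s)))
    where τ = mkPartition xs (Linked.tail xs↓) xs>0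
  ∈-approximation⁺ (suc s) (mkPartition [] _ _) _ _ | tri> _ _ ()
  ∈-approximation⁺ (suc s) α@(mkPartition (x ∷ xs) xs↓ (0<x ∷ xs>0)) stable (s≤s α≤s) | tri> _ _ wide =
    subst₂ (λ γ k → γ ∈ approximation (suc s) k) widened (trans (ℕ.+-comm ℓ (firstPart β)) (proj₁ st))
      (∈-widenFirst s (firstPart β) β (∈-approximation⁺ s β
        (λ γ steps → stable γ (step⇒horizontal α β 0 z<s st ◅ steps))
        (ℕ.<-≤-trans (subst (firstPart β <_) (proj₁ st) (ℕ.m<m+n (firstPart β) z<s)) α≤s)))
    where
    -- A first difference above n is at least ℓ, which is the condition for a horizontal hook in row
    -- 0.
    removal′ = removeHook α 0 0
      ( subst₂ _≤_ (sym (ℕ.+-suc (entry xs 0) n)) (sym (ℕ.+-identityʳ x)) wide , ℕ.+-monoʳ-< x z<s )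
    open Removal removal′ renaming (rest to β)
    st : HorizontalStep ℓ (entry (parts α)) (entry (parts β)) 0
    st = trans (sym ℓ-size) (ℕ.+-identityʳ x)
       , λ { zero 0≢0 → contradiction refl 0≢0 ; (suc i) _ → outside (suc i) (inj₂ z<s) }
    widened : widenFirst β ≡ α
    widened = ≗⇒≡ λ
      { zero    → trans (sym (proj₁ (widenFirst-step β))) (proj₁ st)
      ; (suc i) → trans (sym (proj₂ (widenFirst-step β) (suc i) λ ())) (proj₂ st (suc i) λ ()) }

  shortCores-unique : ∀ k → Unique (shortCores k)
  shortCores-unique k = AllPairs.map⁺ (allPairs-∈ distinct′ (zeroVectors-unique n k))
    where
    distinct′ : ∀ {g g′} → g ∈ zeroVectors n k → g′ ∈ zeroVectors n k → g ≢ g′ → corePartition g ≢ corePartition g′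
    distinct′ {g} {g′} g∈ g′∈ g≢g′ eq = g≢g′ (core-injective (corePartition-core g)
      (subst₂ (λ m α → Core m (parts α) g′)
        (trans (proj₁ (∈-zeroVectors⁻ n k g′∈)) (sym (proj₁ (∈-zeroVectors⁻ n k g∈)))) (sym eq) (corePartition-core g′)))

  -- The three families are disjoint because their first differences are below, equal to and above
  -- n.
  approximation-unique : ∀ s k → Unique (approximation s k)
  approximation-unique zero    k = []
  approximation-unique (suc s) k = Unique.++⁺ (shortCores-unique k)
    (Unique.++⁺ (Unique.map⁺ addRow-injective (delay-unique n (approximation-unique s) k))
                (Unique.map⁺ widenFirst-injective (delay-unique ℓ (approximation-unique s) k))
                (λ (α∈ , α∈′) → row-wide α∈ α∈′))
    (λ (α∈ , α∈′) → core-others α∈ (∈-++⁻ (map addRow (delay n (approximation s) k)) α∈′))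
    where
    wide : ∀ {α xs} → α ∈ map widenFirst xs → entry (parts α) 1 + n < firstPart α
    wide α∈ with β , _ , refl ← ∈-map⁻ widenFirst α∈ = begin-strict
      entry (parts (widenFirst β)) 1 + n  ≡⟨ cong (_+ n) (proj₂ (widenFirst-step β) 1 λ ()) ⟨
      entry (parts β) 1 + n               ≤⟨ ℕ.+-monoˡ-≤ n (entry-antitone (decreasing β) 0) ⟩
      firstPart β + n                     <⟨ ℕ.+-monoʳ-< (firstPart β) (ℕ.n<1+n n) ⟩
      firstPart β + ℓ                     ≡⟨ proj₁ (widenFirst-step β) ⟩
      firstPart (widenFirst β)            ∎
      where open ℕ.≤-Reasoning
    exact : ∀ {α xs} → α ∈ map addRow xs → firstPart α ≡ entry (parts α) 1 + n
    exact α∈ with β , _ , refl ← ∈-map⁻ addRow α∈ = ℕ.+-comm n (firstPart β)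
    row-wide : ∀ {α xs ys} → α ∈ map addRow xs → α ∈ map widenFirst ys → ⊥
    row-wide α∈ α∈′ = ℕ.<⇒≢ (wide α∈′) (sym (exact α∈))
    core-others : ∀ {α xs ys} → α ∈ shortCores k → α ∈ map addRow xs ⊎ α ∈ map widenFirst ys → ⊥
    core-others α∈ α∈′ with _ , c , 0∈g , _ ← ∈-shortCores⁻ k α∈ | α∈′
    ... | inj₁ α∈ᵐ = ℕ.<⇒≢ (core-short c 0∈g) (exact α∈ᵐ)
    ... | inj₂ α∈ᵐ = ℕ.<-asym (core-short c 0∈g) (wide α∈ᵐ)

  solution-hasSize : ∀ k → HasSize (λ α → IsℓPartition ℓ α × firstPart α ≡ k) (length (solution k))
  solution-hasSize k = solution k , approximation-unique (suc k) k , (λ α → mk⇔ to from) , refl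
    where
    to : ∀ {α} → α ∈ solution k → IsℓPartition ℓ α × firstPart α ≡ k
    to {α} α∈ with gen , eq ← ∈-approximation⁻ (suc k) k α∈ = record
      { regular         = noNonHorizontal⇒regular t α (generated⇒stable α gen α ε)
      ; noNonHorizontal = generated⇒stable α gen
      } , eq
    from : ∀ {α} → IsℓPartition ℓ α × firstPart α ≡ k → α ∈ solution k
    from {α} (isℓ , refl) = ∈-approximation⁺ (suc k) α (IsℓPartition.noNonHorizontal isℓ) ℕ.≤-refl

  shortCores-series : (𝟙 - X) ^ n * ‖ shortCores ‖ ≈ 𝟙 - X ^ n
  shortCores-series k = trans
    (*-congˡ ((𝟙 - X) ^ n) {‖ shortCores ‖} {‖ zeroVectors n ‖} (λ j → cong ℤ.+_ (length-map corePartition (zeroVectors n j))) k)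
    (zeroVectors-series n k)

  denominator : PowerSeries
  denominator = (𝟙 - X) ^ n * (𝟙 - X ^ n - X ^ ℓ)

  denominator₀ : denominator 0 ≡ 1ℤ
  denominator₀ = trans (ℤ.+-identityʳ _) (trans (ℤ.*-identityʳ (((𝟙 - X) ^ n) 0)) (power₀ n))
    where
    power₀ : ∀ m → ((𝟙 - X) ^ m) 0 ≡ 1ℤ
    power₀ zero    = refl
    power₀ (suc m) = trans (ℤ.+-identityʳ _) (trans (ℤ.*-identityˡ (((𝟙 - X) ^ m) 0)) (power₀ m))

  solution-quotient : ‖ solution ‖ ≈ (𝟙 - X ^ n) / denominator
  solution-quotient = /-unique ‖ solution ‖ denominator (𝟙 - X ^ n) denominator₀ λ k →
    trans (x∙yz≈y∙xz ‖ solution ‖ ((𝟙 - X) ^ n) (𝟙 - X ^ n - X ^ ℓ) k)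
    (trans (*-congˡ ((𝟙 - X) ^ n) solution-series k) (shortCores-series k))

theorem2p3p3p1 : ∀ (ℓ : ℕ) → 2 ≤ ℓ →
    Σ[ b ∈ (ℕ → ℕ) ]
    (∀ k → HasSize (λ α → IsℓPartition ℓ α × firstPart α ≡ k) (b k)) ×
    generatingSeries b ≈
    (𝟙 - X ^ (ℓ ∸ 1)) / ((𝟙 - X) ^ (ℓ ∸ 1) * (𝟙 - X ^ (ℓ ∸ 1) - X ^ ℓ))
theorem2p3p3p1 (suc (suc t)) (s≤s (s≤s z≤n)) =
  length ∘ Recurrence.solution (shortCores t) (addRow t) (widenFirst t) t , solution-hasSize t , solution-quotient t
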